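{- Let $C$ be a completely regular code in $J(n,4)$ with covering radius $2$ and $Spec(C)=\{\theta_0(n,4),\theta_2(n,4),\theta_3(n,4)\}$. Then $C$ has intersection matrix $$\begin{pmatrix} 4n-16-\beta_0 & \beta_0 & 0\\ -\frac{(\beta_0-2n+2)(\beta_0-3n+6)}{\beta_0-\gamma_2} & \beta_0+\gamma_2-n-8 & \frac{(\gamma_2-2n+2)(\gamma_2-3n+6)}{\beta_0-\gamma_2}\\ 0 & \gamma_2 & 4n-16-\gamma_2\end{pmatrix}$$ for some distinct positive integers $\beta_0$ and $\gamma_2$.
   Context: The Johnson graph $J(n,4)$ has as vertices the $4$-subsets of $\{1,\dots,n\}$ ($n\ge 8$), adjacent iff they meet in a $3$-subset; its eigenvalues are $\theta_i(n,4)=(n-4-i)(4-i)-i$, $i=0,\dots,4$. For a code $C$, $C_i$ is the set of vertices at distance exactly $i$ from $C$, the covering radius $\rho$ is the largest $i$ with $C_i\ne\emptyset$; $C$ is completely regular if there are numbers $\alpha_i,\beta_i,\gamma_i$ such that each vertex of $C_i$ has exactly $\alpha_i,\beta_i,\gamma_i$ neighbours in $C_i,C_{i+1},C_{i-1}$. The intersection matrix is the $(\rho+1)\times(\rho+1)$ tridiagonal matrix with diagonal $\alpha_0,\dots,\alpha_\rho$, superdiagonal $\beta_0,\dots,\beta_{\rho-1}$, subdiagonal $\gamma_1,\dots,\gamma_\rho$, and $Spec(C)$ is its set of eigenvalues. -}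

module Defs where

open import Data.Nat using (ℕ; zero; suc; _≡ᵇ_; _≤_)
open import Data.Bool using (Bool; true; false; _∧_; _∨_; not)
open import Data.List using (List; []; _∷_; _++_; map; filter; length)
open import Data.Bool.ListAction using (any)
open import Data.Vec using ([]; _∷_)
open import Data.Fin using (Fin; zero; suc)
open import Data.Fin.Subset using (Subset; _∩_; ∣_∣)
open import Data.Integer using (ℤ; +_; _-_; _*_; _+_)
open import Relation.Binary.PropositionalEquality using (_≡_)
open import Data.Product using (Σ; _×_)
open import Data.Unit using (⊤)
open import Data.Fin.Patterns using (0F; 1F; 2F)
import Data.Fin
open import Relation.Nullary using (yes; no)
open import Relation.Nullary.Decidable using (Dec)
open import Data.Bool.Properties using () renaming (_≟_ to _≟ᵇ_)

IsVertex : {n : ℕ} → Subset n → Set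
IsVertex s = ∣ s ∣ ≡ 4

allSubsets : (n : ℕ) → List (Subset n)
allSubsets zero    = [] ∷ []
allSubsets (suc n) = map (true ∷_) (allSubsets n) ++ map (false ∷_) (allSubsets n)

vertices : (n : ℕ) → List (Subset n)
vertices n = filter (λ s → (∣ s ∣ ≡ᵇ 4) ≟ᵇ true) (allSubsets n)

adj : {n : ℕ} → Subset n → Subset n → Bool
adj s t = ∣ s ∩ t ∣ ≡ᵇ 3

-- Codes and distance partition.  A code is given by its (Boolean)
-- characteristic function on vertices.

Code : ℕ → Set
Code n = Subset n → Bool

atMost : {n : ℕ} → Code n → ℕ → Subset n → Bool
atMost C zero    v = C v
atMost {n} C (suc k) v = atMost C k v ∨ any (λ w → adj v w ∧ atMost C k w) (vertices n)

layer : {n : ℕ} → Code n → ℕ → Subset n → Bool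
layer C zero    v = C v
layer C (suc i) v = atMost C (suc i) v ∧ not (atMost C i v)

nbrsIn : {n : ℕ} → Code n → ℕ → Subset n → ℕ
nbrsIn {n} C j v = length (filter (λ w → (adj v w ∧ layer C j w) ≟ᵇ true) (vertices n))

-- covering radius of C equals ρ: C_ρ ≠ ∅, and every vertex lies within
-- distance ρ of C (so C_i = ∅ for all i > ρ)
CoveringRadius : {n : ℕ} → Code n → ℕ → Set
CoveringRadius {n} C ρ =
  (Σ (Subset n) (λ v → IsVertex v × (layer C ρ v ≡ true)))
  × ((v : Subset n) → IsVertex v → atMost C ρ v ≡ true)

γCond : {n : ℕ} → Code n → (ℕ → ℕ) → ℕ → Subset n → Set
γCond C γ zero    v = ⊤
γCond C γ (suc i) v = nbrsIn C i v ≡ γ (suc i)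

IsCompletelyRegular : {n : ℕ} → Code n → ℕ → (α β γ : ℕ → ℕ) → Set
IsCompletelyRegular {n} C ρ α β γ =
  CoveringRadius C ρ
  × ((i : ℕ) → i ≤ ρ → (v : Subset n) → IsVertex v → layer C i v ≡ true →
       (nbrsIn C i v ≡ α i) × (nbrsIn C (suc i) v ≡ β i) × γCond C γ i v)

Mat3 : Set
Mat3 = Fin 3 → Fin 3 → ℤ

det3 : Mat3 → ℤ
det3 M =
    M 0F 0F * (M 1F 1F * M 2F 2F - M 1F 2F * M 2F 1F)
  - M 0F 1F * (M 1F 0F * M 2F 2F - M 1F 2F * M 2F 0F)
  + M 0F 2F * (M 1F 0F * M 2F 1F - M 1F 1F * M 2F 0F)

shift : ℤ → Mat3 → Mat3
shift x M i j with i Data.Fin.≟ j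
... | yes _ = x - M i j
... | no  _ = (+ 0) - M i j

IsEigenvalue : ℤ → Mat3 → Set
IsEigenvalue x M = det3 (shift x M) ≡ + 0

intersectionMatrix : (α β γ : ℕ → ℕ) → Mat3
intersectionMatrix α β γ 0F 0F = + α 0
intersectionMatrix α β γ 0F 1F = + β 0
intersectionMatrix α β γ 0F 2F = + 0
intersectionMatrix α β γ 1F 0F = + γ 1
intersectionMatrix α β γ 1F 1F = + α 1
intersectionMatrix α β γ 1F 2F = + β 1
intersectionMatrix α β γ 2F 0F = + 0
intersectionMatrix α β γ 2F 1F = + γ 2
intersectionMatrix α β γ 2F 2F = + α 2

-- eigenvalues θ_i(n,4) = (n-4-i)(4-i) - i of J(n,4), as integers
θ : ℕ → ℕ → ℤ
θ n i = ((+ n) - (+ 4) - (+ i)) * ((+ 4) - (+ i)) - (+ i)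

{-# OPTIONS --safe #-}

-- Every row of the intersection matrix sums to the valency 4(n - 4), so the two remaining eigenvalues
-- determine the trace and the second coefficient of the characteristic polynomial, hence all entries in
-- terms of β₀ and γ₂.  The real content is β₀ ≠ γ₂.
--
-- If β₀ = γ₂, then β₀ = 2n - 2, the function f = β₁ 1_C - γ₁ 1_{C₂} is a θ₂-eigenfunction and, for
-- D = C ∪ C₂, the function g = (3n - 6) 1_D - (n - 4) is a θ₃-eigenfunction.  For distinct x, y, z, w
-- consider the second difference under x ↔ y, z ↔ w over the sets {s, t, x, z}.  For f it does not
-- depend on {s, t}, as f is a sum over pairs.  For 1_D it has the form a(s) + a(t) with a of sum zero
-- over the n - 4 remaining points, as g is a sum over triples whose sums over pairs vanish.  No vertex
-- of C is adjacent to one of C₂, so the second difference of 1_D can only vanish where that of f does.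
-- Hence if the latter is not zero, all a(s) + a(t) lie in {±1, ±2}; this is impossible for n - 4
-- numbers of sum zero unless n - 4 is 4 or 6, and these two cases are excluded by
-- (3n - 6) |D| = (n - 4) C(n, 4).  So all second differences of f vanish, which forces f = 0,
-- contradicting β₁ + γ₁ = n - 4.
module Submission where

open import Defs
open import Data.Nat using (ℕ; _≤_; _<_)
open import Data.Integer using (ℤ; +_; -_; _-_; _*_; _+_)
open import Data.Product using (Σ; _×_; ∃)
open import Relation.Binary.PropositionalEquality using (_≡_; _≢_)

import Algebra.Properties.Semiring.Sum as Sum
open import Data.Bool using (Bool; true; false; _∧_; _∨_; not; if_then_else_)
open import Data.Bool.ListAction using (any)
open import Data.Bool.Properties using () renaming (_≟_ to _≟ᵇ_)
open import Data.Empty using (⊥-elim) renaming (⊥ to Empty)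
open import Data.Fin using (Fin; zero; suc; toℕ)
open import Data.Fin.Patterns using (0F; 1F; 2F)
open import Data.Fin.Properties using (_≟_; all?)
open import Data.Fin.Subset using (Subset; _∩_; ∣_∣; ⊥)
open import Data.Fin.Subset.Properties using (∣p∩q∣≤∣p∣; ∣p∩q∣≤∣q∣; ∣⊥∣≡0; ∩-comm)
import Data.Integer as ℤ
open import Data.Integer using (0ℤ; 1ℤ; +[1+_]; +<+) renaming (_≤_ to _≤ᶻ_; _<_ to _<ᶻ_)
import Data.Integer.Properties as ℤ
open import Data.Integer.Tactic.RingSolver using (solve-∀)
open import Data.List using (List; []; _∷_; _++_; map; filter; length; allFin; tabulate)
open import Data.List.Membership.Propositional using (_∈_)
open import Data.List.Membership.Propositional.Properties using (∈-++⁺ˡ; ∈-++⁺ʳ; ∈-++⁻; ∈-map⁺; ∈-filter⁺; ∈-filter⁻; ∈-∃++; ∈-allFin)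
open import Data.List.Properties using (length-map; length-tabulate; length-++)
open import Data.List.Relation.Binary.Permutation.Propositional using (_↭_; ↭-refl; ↭-sym; ↭-trans; ↭⇒↭ₛ; module _↭_)
open import Data.List.Relation.Binary.Permutation.Propositional.Properties using (++⁺ˡ; ∈-resp-↭; ↭-length) renaming (shift to ↭-shift)
open import Data.List.Relation.Binary.Permutation.Setoid.Properties using (AllPairs-resp-↭)
open import Data.List.Relation.Unary.All as All using (All; []; _∷_)
import Data.List.Relation.Unary.All.Properties as All
open import Data.List.Relation.Unary.AllPairs as AllPairs using (AllPairs; []; _∷_)
import Data.List.Relation.Unary.AllPairs.Properties as AllPairs
open import Data.List.Relation.Unary.Any using (here; there)
open import Data.List.Relation.Unary.Unique.Propositional.Properties using (allFin⁺)
open import Data.Nat as ℕ using (zero; suc; _≡ᵇ_; z≤n; s≤s)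
open import Data.Nat.Divisibility using (_∣?_; divides)
import Data.Nat.Properties as ℕ
open import Data.Product using (∃₂; _,_; proj₁; proj₂)
open import Data.Sum using (_⊎_; inj₁; inj₂; [_,_]′)
open import Data.Vec using ([]; _∷_; lookup; _[_]≔_)
open import Data.Vec.Properties using ([]≔-commutes; []≔-idempotent; []≔-lookup; lookup-replicate; lookup∘update; lookup∘update′)
open import Function using (_∘_)
open import Relation.Binary.PropositionalEquality
  using (refl; sym; trans; cong; cong₂; subst; subst₂; ≢-sym; resp₂; setoid; module ≡-Reasoning)
open import Relation.Nullary using (yes; no; ¬_)
open import Relation.Nullary.Decidable using (from-yes; from-no; decidable-stable; does; _→-dec_; _×-dec_; _⊎-dec_)

open Sum ℤ.+-*-semiring using (sum; sum-cong-≗; sum-replicate-zero; ∑-distrib-+; *-distribˡ-sum)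

-- Sums over neighbourhoods

-- The spectrum alone cannot give β₀ ≠ γ₂: every such matrix with row sums 4(n - 4), β₀ = γ₂ = 2n -
-- 2 and γ₁ + β₁ = n - 4 has the eigenvalues θ₀, θ₂, θ₃, and both formulas with denominator β₀ - γ₂
-- degenerate to 0 = 0. So the combinatorics of J(n,4) has to enter. It does so through one
-- factorisation: A + 4, with A the adjacency operator, adds up, over the four triples of a vertex,
-- the sums over all vertices through the triple; that is, A + 4 is the inclusion matrix of triples
-- in vertices times its transpose. Summing an eigenvalue equation over one free point then relates
-- sums over triples to sums over pairs, and those to sums over points. All relations stay in the
-- integers, with factors such as n - 4, 2n - 10, n - 6 and 3n - 6 kept on one side. The second
-- difference suits both eigenspaces: for f it cancels every pair that meets {s, t}, for g every
-- triple through both s and t, and its four sets form a 4-cycle in J(n,4), so that the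
-- non-adjacency of C and C₂ restricts its values.

χ : Bool → ℤ
χ true  = 1ℤ
χ false = 0ℤ

-- Unlike the filtered list `vertices`, this sum splits along the first point of the ground set, so
-- neighbourhood sums can be computed by induction on n. `∑ₗ-allSubsets` links the two.
∑ₛ : ∀ {n} → (Subset n → ℤ) → ℤ
∑ₛ {zero}  φ = φ []
∑ₛ {suc n} φ = ∑ₛ (λ s → φ (true ∷ s)) + ∑ₛ (λ s → φ (false ∷ s))

∑ₛ-cong : ∀ {n} {φ ψ : Subset n → ℤ} → (∀ s → φ s ≡ ψ s) → ∑ₛ φ ≡ ∑ₛ ψ
∑ₛ-cong {zero}  e = e []
∑ₛ-cong {suc n} e = cong₂ _+_ (∑ₛ-cong (e ∘ (true ∷_))) (∑ₛ-cong (e ∘ (false ∷_)))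

∑ₛ-zero : ∀ {n} {φ : Subset n → ℤ} → (∀ s → φ s ≡ 0ℤ) → ∑ₛ φ ≡ 0ℤ
∑ₛ-zero {zero}  e = e []
∑ₛ-zero {suc n} e = cong₂ _+_ (∑ₛ-zero (e ∘ (true ∷_))) (∑ₛ-zero (e ∘ (false ∷_)))

_∖_ : ∀ {n} → Subset n → Fin n → Subset n
s ∖ x = s [ x ]≔ false

_⊹_ : ∀ {n} → Subset n → Fin n → Subset n
s ⊹ x = s [ x ]≔ true

infixl 7 _∖_ _⊹_

within : ∀ {n} → Subset n → (Fin n → ℤ) → Fin n → ℤ
within s ψ i = χ (lookup s i) * ψ i

outside : ∀ {n} → Subset n → (Fin n → ℤ) → Fin n → ℤ
outside s ψ i = χ (not (lookup s i)) * ψ i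

-- The first test concerns the size of w, the second the size of v ∩ w, for a fixed v; equal sizes
-- and an intersection one smaller express adjacency. Successors replace subtraction, so that the
-- tests reduce when a first point is removed.
sizes : ℕ → ℕ → ℕ → ℕ → ℤ
sizes a b c d = χ (a ≡ᵇ b) * χ (c ≡ᵇ d)

<⇒≢ᵇ : ∀ {a b} → a < b → (a ≡ᵇ b) ≡ false
<⇒≢ᵇ {zero}  {suc b} _           = refl
<⇒≢ᵇ {suc a} {suc b} (s≤s a<b) = <⇒≢ᵇ a<b

≡ᵇ⇒≡ : ∀ a b → (a ≡ᵇ b) ≡ true → a ≡ b
≡ᵇ⇒≡ zero    zero    _ = refl
≡ᵇ⇒≡ (suc a) (suc b) e = cong suc (≡ᵇ⇒≡ a b e)

≡⇒≡ᵇ : ∀ {a b} → a ≡ b → (a ≡ᵇ b) ≡ true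
≡⇒≡ᵇ {zero}  refl = refl
≡⇒≡ᵇ {suc a} refl = ≡⇒≡ᵇ {a} refl

sizes-zero : ∀ a b c d → (a ≡ b → c < d) → ∀ z → sizes a b c d * z ≡ 0ℤ
sizes-zero a b c d h z with a ≡ᵇ b in e
... | false = refl
... | true  rewrite <⇒≢ᵇ (h (≡ᵇ⇒≡ a b e)) = refl

-- Equal size and full intersection leave only w = v.
∑-equal : ∀ {n} (v : Subset n) (φ : Subset n → ℤ) →
  ∑ₛ (λ w → sizes (∣ w ∣) (∣ v ∣) (∣ v ∩ w ∣) (∣ v ∣) * φ w) ≡ φ v
∑-equal []          φ = ℤ.*-identityˡ (φ [])
∑-equal (true ∷ v)  φ = trans
  (cong₂ _+_ (∑-equal v (φ ∘ (true ∷_)))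
     (∑ₛ-zero (λ w → sizes-zero (∣ w ∣) _ _ _ (λ _ → s≤s (∣p∩q∣≤∣p∣ v w)) (φ (false ∷ w)))))
  (ℤ.+-identityʳ _)
∑-equal (false ∷ v) φ = trans
  (cong₂ _+_
     (∑ₛ-zero (λ w → sizes-zero (suc (∣ w ∣)) (∣ v ∣) (∣ v ∩ w ∣) (∣ v ∣)
        (λ e → subst (∣ v ∩ w ∣ <_) e (s≤s (∣p∩q∣≤∣q∣ v w))) (φ (true ∷ w))))
     (∑-equal v (φ ∘ (false ∷_))))
  (ℤ.+-identityˡ _)

∑-larger : ∀ {n} (v : Subset n) (φ : Subset n → ℤ) →
  ∑ₛ (λ w → sizes (∣ w ∣) (suc (∣ v ∣)) (∣ v ∩ w ∣) (∣ v ∣) * φ w) ≡ sum (outside v (λ x → φ (v ⊹ x)))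
∑-larger []          φ = refl
∑-larger (true ∷ v)  φ = trans
  (cong₂ _+_ (∑-larger v (φ ∘ (true ∷_)))
     (∑ₛ-zero (λ w → sizes-zero (∣ w ∣) _ _ _ (λ _ → s≤s (∣p∩q∣≤∣p∣ v w)) (φ (false ∷ w)))))
  (ℤ.+-comm (sum (outside v (λ x → φ (true ∷ v ⊹ x)))) 0ℤ)
∑-larger (false ∷ v) φ =
  cong₂ _+_ (trans (∑-equal v (φ ∘ (true ∷_))) (sym (ℤ.*-identityˡ _))) (∑-larger v (φ ∘ (false ∷_)))

∑-smaller : ∀ {n} (v : Subset n) (φ : Subset n → ℤ) →
  ∑ₛ (λ w → sizes (suc (∣ w ∣)) (∣ v ∣) (suc (∣ v ∩ w ∣)) (∣ v ∣) * φ w) ≡ sum (within v (λ x → φ (v ∖ x)))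
∑-smaller []          φ = refl
∑-smaller (true ∷ v)  φ = trans
  (cong₂ _+_ (∑-smaller v (φ ∘ (true ∷_))) (∑-equal v (φ ∘ (false ∷_))))
  (trans (ℤ.+-comm S (φ (false ∷ v))) (cong (_+ S) (sym (ℤ.*-identityˡ (φ (false ∷ v))))))
  where S = sum (within v (λ x → φ (true ∷ v ∖ x)))
∑-smaller (false ∷ v) φ = cong₂ _+_
  (∑ₛ-zero (λ w → sizes-zero (suc (suc (∣ w ∣))) (∣ v ∣) (suc (∣ v ∩ w ∣)) (∣ v ∣)
     (λ e → subst (suc (∣ v ∩ w ∣) <_) e (s≤s (s≤s (∣p∩q∣≤∣q∣ v w)))) (φ (true ∷ w))))
  (∑-smaller v (φ ∘ (false ∷_)))

-- Removing a first point that lies in only one of v and w unbalances their sizes: what remains of w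
-- is then a superset of v with one point more, or a subset with one point less. Hence the induction
-- also needs `∑-larger` and `∑-smaller`, and these in turn need `∑-equal`.
∑-exchange : ∀ {n} (v : Subset n) (φ : Subset n → ℤ) →
  ∑ₛ (λ w → sizes (∣ w ∣) (∣ v ∣) (suc (∣ v ∩ w ∣)) (∣ v ∣) * φ w)
    ≡ sum (within v (λ i → sum (outside v (λ x → φ (v ∖ i ⊹ x)))))
∑-exchange []          φ = refl
∑-exchange (true ∷ v)  φ = trans
  (cong₂ _+_ (∑-exchange v (φ ∘ (true ∷_))) (∑-larger v (φ ∘ (false ∷_))))
  (trans (ℤ.+-comm (sum (within v E)) L) (cong₂ _+_
    (sym (trans (ℤ.*-identityˡ (0ℤ + L)) (ℤ.+-identityˡ L)))
    (sum-cong-≗ (λ i → cong (χ (lookup v i) *_) (sym (ℤ.+-identityˡ (E i)))))))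
  where
  E = λ i → sum (outside v (λ x → φ (true ∷ v ∖ i ⊹ x)))
  L = sum (outside v (λ x → φ (false ∷ v ⊹ x)))
∑-exchange (false ∷ v) φ = trans
  (cong₂ _+_ (∑-smaller v (φ ∘ (true ∷_))) (∑-exchange v (φ ∘ (false ∷_))))
  (trans (sym (∑-distrib-+ (within v S) (within v E)))
  (trans (sum-cong-≗ (λ i → trans (sym (ℤ.*-distribˡ-+ (χ (lookup v i)) (S i) (E i)))
       (cong (λ z → χ (lookup v i) * (z + E i)) (sym (ℤ.*-identityˡ (S i))))))
  (sym (ℤ.+-identityˡ _))))
  where
  S = λ i → φ (true ∷ v ∖ i)
  E = λ i → sum (outside v (λ x → φ (false ∷ v ∖ i ⊹ x)))

∑ₗ : ∀ {A : Set} → List A → (A → ℤ) → ℤ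
∑ₗ []       φ = 0ℤ
∑ₗ (x ∷ xs) φ = φ x + ∑ₗ xs φ

∑ₗ-++ : ∀ {A : Set} (xs ys : List A) (φ : A → ℤ) → ∑ₗ (xs ++ ys) φ ≡ ∑ₗ xs φ + ∑ₗ ys φ
∑ₗ-++ []       ys φ = sym (ℤ.+-identityˡ _)
∑ₗ-++ (x ∷ xs) ys φ = trans (cong (λ z → φ x + z) (∑ₗ-++ xs ys φ)) (sym (ℤ.+-assoc (φ x) _ _))

∑ₗ-map : ∀ {A B : Set} (f : A → B) xs (φ : B → ℤ) → ∑ₗ (map f xs) φ ≡ ∑ₗ xs (φ ∘ f)
∑ₗ-map f []       φ = refl
∑ₗ-map f (x ∷ xs) φ = cong (λ z → φ (f x) + z) (∑ₗ-map f xs φ)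

∑ₗ-filter : ∀ {A : Set} (p : A → Bool) xs (φ : A → ℤ) → ∑ₗ (filter (λ x → p x ≟ᵇ true) xs) φ ≡ ∑ₗ xs (λ x → χ (p x) * φ x)
∑ₗ-filter p []       φ = refl
∑ₗ-filter p (x ∷ xs) φ with p x
... | true  = cong₂ _+_ (sym (ℤ.*-identityˡ (φ x))) (∑ₗ-filter p xs φ)
... | false = trans (∑ₗ-filter p xs φ) (sym (ℤ.+-identityˡ _))

length-filter : ∀ {A : Set} (p : A → Bool) xs → + length (filter (λ x → p x ≟ᵇ true) xs) ≡ ∑ₗ xs (χ ∘ p)
length-filter p []       = refl
length-filter p (x ∷ xs) with p x
... | true  = cong (λ z → 1ℤ + z) (length-filter p xs)
... | false = trans (length-filter p xs) (sym (ℤ.+-identityˡ _))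

∑ₗ-cong : ∀ {A : Set} (xs : List A) {φ ψ : A → ℤ} → (∀ x → φ x ≡ ψ x) → ∑ₗ xs φ ≡ ∑ₗ xs ψ
∑ₗ-cong []       e = refl
∑ₗ-cong (x ∷ xs) e = cong₂ _+_ (e x) (∑ₗ-cong xs e)

∑ₗ-distrib-+ : ∀ {A : Set} (xs : List A) (φ ψ : A → ℤ) → ∑ₗ xs (λ x → φ x + ψ x) ≡ ∑ₗ xs φ + ∑ₗ xs ψ
∑ₗ-distrib-+ []       φ ψ = refl
∑ₗ-distrib-+ (x ∷ xs) φ ψ = trans (cong (λ z → (φ x + ψ x) + z) (∑ₗ-distrib-+ xs φ ψ)) (interchange (φ x) (ψ x) _ _)
  where
  interchange : ∀ a b c d → (a + b) + (c + d) ≡ (a + c) + (b + d)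
  interchange = solve-∀

∑ₗ-distribˡ-* : ∀ {A : Set} (xs : List A) c (φ : A → ℤ) → ∑ₗ xs (λ x → c * φ x) ≡ c * ∑ₗ xs φ
∑ₗ-distribˡ-* []       c φ = sym (ℤ.*-zeroʳ c)
∑ₗ-distribˡ-* (x ∷ xs) c φ = trans (cong (λ z → c * φ x + z) (∑ₗ-distribˡ-* xs c φ)) (sym (ℤ.*-distribˡ-+ c _ _))

∑ₗ-zero : ∀ {A : Set} (xs : List A) → ∑ₗ xs (λ _ → 0ℤ) ≡ 0ℤ
∑ₗ-zero []       = refl
∑ₗ-zero (_ ∷ xs) = trans (ℤ.+-identityˡ _) (∑ₗ-zero xs)

∑ₗ-comm : ∀ {A B : Set} (xs : List A) (ys : List B) (φ : A → B → ℤ) →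
  ∑ₗ xs (λ x → ∑ₗ ys (φ x)) ≡ ∑ₗ ys (λ y → ∑ₗ xs (λ x → φ x y))
∑ₗ-comm []       ys φ = sym (∑ₗ-zero ys)
∑ₗ-comm (x ∷ xs) ys φ = trans (cong (λ z → ∑ₗ ys (φ x) + z) (∑ₗ-comm xs ys φ)) (sym (∑ₗ-distrib-+ ys (φ x) _))

∑ₗ-allSubsets : ∀ n (φ : Subset n → ℤ) → ∑ₗ (allSubsets n) φ ≡ ∑ₛ φ
∑ₗ-allSubsets zero    φ = ℤ.+-identityʳ _
∑ₗ-allSubsets (suc n) φ = trans (∑ₗ-++ (map (true ∷_) (allSubsets n)) _ φ)
  (cong₂ _+_ (trans (∑ₗ-map (true ∷_) (allSubsets n) φ) (∑ₗ-allSubsets n _))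
             (trans (∑ₗ-map (false ∷_) (allSubsets n) φ) (∑ₗ-allSubsets n _)))

nbrSum : ∀ {n} → (Subset n → ℤ) → Subset n → ℤ
nbrSum {n} φ v = ∑ₗ (vertices n) (λ w → χ (adj v w) * φ w)

nbrSum-exchange : ∀ {n} (v : Subset n) (φ : Subset n → ℤ) → IsVertex v →
  nbrSum φ v ≡ sum (within v (λ i → sum (outside v (λ x → φ (v ∖ i ⊹ x)))))
nbrSum-exchange {n} v φ ∣v∣≡4 = begin
  nbrSum φ v
    ≡⟨ ∑ₗ-filter (λ s → ∣ s ∣ ≡ᵇ 4) (allSubsets n) _ ⟩
  ∑ₗ (allSubsets n) (λ w → χ (∣ w ∣ ≡ᵇ 4) * (χ (adj v w) * φ w))
    ≡⟨ ∑ₗ-allSubsets n _ ⟩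
  ∑ₛ (λ w → χ (∣ w ∣ ≡ᵇ 4) * (χ (adj v w) * φ w))
    -- `suc x ≡ᵇ 4` reduces to `x ≡ᵇ 3`, so `adj` has the required form once 4 is replaced by the
    -- size of v.
    ≡⟨ ∑ₛ-cong (λ w → trans (sym (ℤ.*-assoc (χ (∣ w ∣ ≡ᵇ 4)) _ _))
         (cong (λ k → sizes (∣ w ∣) k (suc (∣ v ∩ w ∣)) k * φ w) (sym ∣v∣≡4))) ⟩
  ∑ₛ (λ w → sizes (∣ w ∣) (∣ v ∣) (suc (∣ v ∩ w ∣)) (∣ v ∣) * φ w)
    ≡⟨ ∑-exchange v φ ⟩
  sum (within v (λ i → sum (outside v (λ x → φ (v ∖ i ⊹ x))))) ∎
  where open ≡-Reasoning

-- Vertices built up by inserting points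

infix 4 _∉ₛ_
_∉ₛ_ : ∀ {n} → Fin n → Subset n → Set
x ∉ₛ s = lookup s x ≡ false

∉-⊥ : ∀ {n} {x : Fin n} → x ∉ₛ ⊥
∉-⊥ {x = x} = lookup-replicate x false

∉-⊹ : ∀ {n} {s : Subset n} {x y} → x ≢ y → y ∉ₛ s → y ∉ₛ s ⊹ x
∉-⊹ {s = s} x≢y y∉s = trans (lookup∘update′ (≢-sym x≢y) s true) y∉s

⊹-comm : ∀ {n} (s : Subset n) x y → s ⊹ x ⊹ y ≡ s ⊹ y ⊹ x
⊹-comm s x y with x ≟ y
... | yes refl = refl
... | no  x≢y  = []≔-commutes s x y x≢y

⊹-∖ : ∀ {n} (s : Subset n) x → x ∉ₛ s → s ⊹ x ∖ x ≡ s
⊹-∖ s x x∉s = trans ([]≔-idempotent s x) (trans (cong (s [ x ]≔_) (sym x∉s)) ([]≔-lookup s x))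

∣⊹∣ : ∀ {n} (s : Subset n) x → x ∉ₛ s → ∣ s ⊹ x ∣ ≡ suc ∣ s ∣
∣⊹∣ (false ∷ s) zero    _ = refl
∣⊹∣ (true ∷ s)  (suc x) e = cong suc (∣⊹∣ s x e)
∣⊹∣ (false ∷ s) (suc x) e = ∣⊹∣ s x e

∩-idem-size : ∀ {n} (s : Subset n) → ∣ s ∩ s ∣ ≡ ∣ s ∣
∩-idem-size []          = refl
∩-idem-size (true ∷ s)  = cong suc (∩-idem-size s)
∩-idem-size (false ∷ s) = ∩-idem-size s

∩-⊹-size : ∀ {n} (s : Subset n) y → y ∉ₛ s → ∣ s ∩ (s ⊹ y) ∣ ≡ ∣ s ∣
∩-⊹-size (false ∷ s) zero    _ = ∩-idem-size s
∩-⊹-size (true ∷ s)  (suc y) e = cong suc (∩-⊹-size s y e)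
∩-⊹-size (false ∷ s) (suc y) e = ∩-⊹-size s y e

⊹-∩-size : ∀ {n} (s : Subset n) y → y ∉ₛ s → ∣ (s ⊹ y) ∩ s ∣ ≡ ∣ s ∣
⊹-∩-size (false ∷ s) zero    _ = ∩-idem-size s
⊹-∩-size (true ∷ s)  (suc y) e = cong suc (⊹-∩-size s y e)
⊹-∩-size (false ∷ s) (suc y) e = ⊹-∩-size s y e

⊹-∩-⊹-size : ∀ {n} (s : Subset n) x y → x ≢ y → x ∉ₛ s → y ∉ₛ s → ∣ (s ⊹ x) ∩ (s ⊹ y) ∣ ≡ ∣ s ∣
⊹-∩-⊹-size s           zero    zero    x≢y _ _ = ⊥-elim (x≢y refl)
⊹-∩-⊹-size (false ∷ s) zero    (suc y) x≢y p q = ∩-⊹-size s y q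
⊹-∩-⊹-size (false ∷ s) (suc x) zero    x≢y p q = ⊹-∩-size s x p
⊹-∩-⊹-size (true ∷ s)  (suc x) (suc y) x≢y p q = cong suc (⊹-∩-⊹-size s x y (x≢y ∘ cong suc) p q)
⊹-∩-⊹-size (false ∷ s) (suc x) (suc y) x≢y p q = ⊹-∩-⊹-size s x y (x≢y ∘ cong suc) p q

empty⇒⊥ : ∀ {n} (s : Subset n) → ∣ s ∣ ≡ 0 → s ≡ ⊥
empty⇒⊥ []          _ = refl
empty⇒⊥ (false ∷ s) e = cong (false ∷_) (empty⇒⊥ s e)

uninsert : ∀ {n k} (s : Subset n) → ∣ s ∣ ≡ suc k → ∃₂ λ u x → s ≡ u ⊹ x × x ∉ₛ u × ∣ u ∣ ≡ k
uninsert (true ∷ s)  e = (false ∷ s) , zero , refl , refl , ℕ.suc-injective e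
uninsert (false ∷ s) e with uninsert s e
... | u , x , refl , x∉u , ∣u∣ = (false ∷ u) , suc x , refl , x∉u , ∣u∣

∉⇒≢ : ∀ {n} {s : Subset n} {x y} → y ∉ₛ s ⊹ x → x ≢ y
∉⇒≢ {s = s} {x} y∉ refl with trans (sym (lookup∘update x s true)) y∉
... | ()

∉-tail : ∀ {n} {s : Subset n} {x y} → y ∉ₛ s ⊹ x → y ∉ₛ s
∉-tail {s = s} {x} {y} y∉ = trans (sym (lookup∘update′ (≢-sym (∉⇒≢ {s = s} {x} y∉)) s true)) y∉

sum-within-⊥ : ∀ {n} ψ → sum (within {n} ⊥ ψ) ≡ 0ℤ
sum-within-⊥ {zero}  ψ = refl
sum-within-⊥ {suc n} ψ = trans (ℤ.+-identityˡ _) (sum-within-⊥ (ψ ∘ suc))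

sum-within-⊹ : ∀ {n} (s : Subset n) x ψ → x ∉ₛ s → sum (within (s ⊹ x) ψ) ≡ ψ x + sum (within s ψ)
sum-within-⊹ (false ∷ s) zero    ψ _ = cong₂ _+_ (ℤ.*-identityˡ (ψ zero)) (sym (ℤ.+-identityˡ (sum (within s (ψ ∘ suc)))))
sum-within-⊹ (b ∷ s)     (suc x) ψ e = trans
  (cong (λ z → χ b * ψ zero + z) (sum-within-⊹ s x (ψ ∘ suc) e)) (swap (χ b * ψ zero) (ψ (suc x)) _)
  where
  swap : ∀ a b c → a + (b + c) ≡ b + (a + c)
  swap = solve-∀

sum-outside-⊹ : ∀ {n} (s : Subset n) x ψ → x ∉ₛ s → sum (outside s ψ) ≡ ψ x + sum (outside (s ⊹ x) ψ)
sum-outside-⊹ (false ∷ s) zero    ψ _ = cong₂ _+_ (ℤ.*-identityˡ (ψ zero)) (sym (ℤ.+-identityˡ (sum (outside s (ψ ∘ suc)))))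
sum-outside-⊹ (b ∷ s)     (suc x) ψ e = trans
  (cong (λ z → χ (not b) * ψ zero + z) (sum-outside-⊹ s x (ψ ∘ suc) e)) (swap (χ (not b) * ψ zero) (ψ (suc x)) _)
  where
  swap : ∀ a b c → a + (b + c) ≡ b + (a + c)
  swap = solve-∀

-- With the value 0 when x is already present, these act like hard-core creation operators: they
-- commute and square to zero. Symmetry of `tuple` and its vanishing at repeated points are exactly
-- these two facts.
create : ∀ {n} → Fin n → (Subset n → ℤ) → Subset n → ℤ
create x φ s = outside s (λ y → φ (s ⊹ y)) x

create-cong : ∀ {n} (x : Fin n) {φ ψ : Subset n → ℤ} → (∀ s → φ s ≡ ψ s) → ∀ s → create x φ s ≡ create x ψ s
create-cong x e s = cong (χ (not (lookup s x)) *_) (e (s ⊹ x))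

create-new : ∀ {n} (x : Fin n) (φ : Subset n → ℤ) (s : Subset n) → x ∉ₛ s → create x φ s ≡ φ (s ⊹ x)
create-new x φ s x∉s = trans (cong (λ b → χ (not b) * φ (s ⊹ x)) x∉s) (ℤ.*-identityˡ _)

create-twice : ∀ {n} (x : Fin n) (φ : Subset n → ℤ) s → create x (create x φ) s ≡ 0ℤ
create-twice x φ s = trans
  (cong (χ (not (lookup s x)) *_) (cong (λ b → χ (not b) * φ (s ⊹ x ⊹ x)) (lookup∘update x s true)))
  (ℤ.*-zeroʳ (χ (not (lookup s x))))

create-comm : ∀ {n} (x y : Fin n) (φ : Subset n → ℤ) s → create x (create y φ) s ≡ create y (create x φ) s
create-comm x y φ s with x ≟ y
... | yes refl = refl
... | no  x≢y  = begin
  a * (χ (not (lookup (s ⊹ x) y)) * φ (s ⊹ x ⊹ y)) ≡⟨ cong₂ (λ c z → a * (χ (not c) * φ z)) (lookup∘update′ (≢-sym x≢y) s true) (⊹-comm s x y) ⟩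
  a * (b * z)                                      ≡⟨ swap a b z ⟩
  b * (a * z)                                      ≡⟨ cong (λ c → b * (χ (not c) * z)) (sym (lookup∘update′ x≢y s true)) ⟩
  b * (χ (not (lookup (s ⊹ y) x)) * z)             ∎
  where
  open ≡-Reasoning
  a = χ (not (lookup s x))
  b = χ (not (lookup s y))
  z = φ (s ⊹ y ⊹ x)
  swap : ∀ a b c → a * (b * c) ≡ b * (a * c)
  swap = solve-∀

create-zero : ∀ {n} (x : Fin n) {φ : Subset n → ℤ} → (∀ s → φ s ≡ 0ℤ) → ∀ s → create x φ s ≡ 0ℤ
create-zero x e s = trans (cong (χ (not (lookup s x)) *_) (e (s ⊹ x))) (ℤ.*-zeroʳ (χ (not (lookup s x))))

Distinct₃ : ∀ {n} → Fin n → Fin n → Fin n → Set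
Distinct₃ a b c = a ≢ b × a ≢ c × b ≢ c

Distinct₄ : ∀ {n} → Fin n → Fin n → Fin n → Fin n → Set
Distinct₄ a b c d = Distinct₃ a b c × a ≢ d × b ≢ d × c ≢ d

triple : ∀ {n} → Fin n → Fin n → Fin n → Subset n
triple a b c = ⊥ ⊹ a ⊹ b ⊹ c

quad : ∀ {n} → Fin n → Fin n → Fin n → Fin n → Subset n
quad a b c d = triple a b c ⊹ d

-- φ {a, b, c, d} for distinct arguments and 0 otherwise; the latter allows sums over all of Fin n.
tuple : ∀ {n} → (Subset n → ℤ) → Fin n → Fin n → Fin n → Fin n → ℤ
tuple φ a b c d = create a (create b (create c (create d φ))) ⊥

∉-triple : ∀ {n} {a b c x : Fin n} → a ≢ x → b ≢ x → c ≢ x → x ∉ₛ triple a b c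
∉-triple {a = a} {b} {c} {x} ax bx cx =
  ∉-⊹ {s = ⊥ ⊹ a ⊹ b} cx (∉-⊹ {s = ⊥ ⊹ a} bx (∉-⊹ {s = ⊥} ax (∉-⊥ {x = x})))

create-triple : ∀ {n} {a b c : Fin n} (φ : Subset n → ℤ) → Distinct₃ a b c →
  create a (create b (create c φ)) ⊥ ≡ φ (triple a b c)
create-triple {a = a} {b} {c} φ (ab , ac , bc) =
  trans (create-new a (create b (create c φ)) ⊥ (∉-⊥ {x = a}))
  (trans (create-new b (create c φ) (⊥ ⊹ a) (∉-⊹ {s = ⊥} ab (∉-⊥ {x = b})))
         (create-new c φ (⊥ ⊹ a ⊹ b) (∉-⊹ {s = ⊥ ⊹ a} bc (∉-⊹ {s = ⊥} ac (∉-⊥ {x = c})))))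

tuple-quad : ∀ {n} {a b c d : Fin n} (φ : Subset n → ℤ) → Distinct₄ a b c d → tuple φ a b c d ≡ φ (quad a b c d)
tuple-quad {d = d} φ (abc , ad , bd , cd) =
  trans (create-triple (create d φ) abc) (create-new d φ (triple _ _ _) (∉-triple ad bd cd))

∣quad∣ : ∀ {n} {a b c d : Fin n} → Distinct₄ a b c d → IsVertex (quad a b c d)
∣quad∣ {n} {a} {b} {c} {d} ((ab , ac , bc) , ad , bd , cd) =
  trans (∣⊹∣ (triple a b c) d (∉-triple ad bd cd)) (cong suc
  (trans (∣⊹∣ (⊥ ⊹ a ⊹ b) c (∉-⊹ {s = ⊥ ⊹ a} bc (∉-⊹ {s = ⊥} ac (∉-⊥ {x = c})))) (cong suc
  (trans (∣⊹∣ (⊥ ⊹ a) b (∉-⊹ {s = ⊥} ab (∉-⊥ {x = b}))) (cong suc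
  (trans (∣⊹∣ ⊥ a (∉-⊥ {x = a})) (cong suc (∣⊥∣≡0 n))))))))

vertex⇒quad : ∀ {n} (v : Subset n) → IsVertex v →
  ∃₂ λ a b → ∃₂ λ c d → Distinct₄ a b c d × v ≡ quad a b c d
vertex⇒quad v e with uninsert v e
... | v₁ , d , refl , d∉ , e₁ with uninsert v₁ e₁
... | v₂ , c , refl , c∉ , e₂ with uninsert v₂ e₂
... | v₃ , b , refl , b∉ , e₃ with uninsert v₃ e₃
... | v₄ , a , refl , a∉ , e₄ with empty⇒⊥ v₄ e₄
... | refl = a , b , c , d ,
  ( ( ∉⇒≢ {s = ⊥} b∉ , ∉⇒≢ {s = ⊥} (∉-tail {s = ⊥ ⊹ a} {b} c∉) , ∉⇒≢ {s = ⊥ ⊹ a} c∉)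
  , ∉⇒≢ {s = ⊥} (∉-tail {s = ⊥ ⊹ a} {b} (∉-tail {s = ⊥ ⊹ a ⊹ b} {c} d∉))
  , ∉⇒≢ {s = ⊥ ⊹ a} (∉-tail {s = ⊥ ⊹ a ⊹ b} {c} d∉) , ∉⇒≢ {s = ⊥ ⊹ a ⊹ b} d∉) , refl

module _ {n} (φ : Subset n → ℤ) where

  tuple-swap₁₂ : ∀ a b c d → tuple φ a b c d ≡ tuple φ b a c d
  tuple-swap₁₂ a b c d = create-comm a b (create c (create d φ)) ⊥

  tuple-swap₂₃ : ∀ a b c d → tuple φ a b c d ≡ tuple φ a c b d
  tuple-swap₂₃ a b c d = create-cong a (create-comm b c (create d φ)) ⊥

  tuple-swap₃₄ : ∀ a b c d → tuple φ a b c d ≡ tuple φ a b d c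
  tuple-swap₃₄ a b c d = create-cong a (create-cong b (create-comm c d φ)) ⊥

  tuple-repeat : ∀ a c d → tuple φ a a c d ≡ 0ℤ
  tuple-repeat a c d = create-twice a (create c (create d φ)) ⊥

  -- The trivial exchange x = i, which gives back u ⊹ i, is missing from the sum over outside
  -- points. The added φ (u ⊹ i) supplies it, and the result no longer depends on i.
  exchange-at : ∀ (u : Subset n) i → i ∉ₛ u →
    sum (outside (u ⊹ i) (λ x → φ (u ⊹ i ∖ i ⊹ x))) + φ (u ⊹ i) ≡ sum (λ x → create x φ u)
  exchange-at u i i∉u = begin
    sum (outside (u ⊹ i) (λ x → φ (u ⊹ i ∖ i ⊹ x))) + φ (u ⊹ i)
      ≡⟨ cong (λ s → sum (outside (u ⊹ i) (λ x → φ (s ⊹ x))) + φ (u ⊹ i)) (⊹-∖ u i i∉u) ⟩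
    sum (outside (u ⊹ i) (λ x → φ (u ⊹ x))) + φ (u ⊹ i)
      ≡⟨ ℤ.+-comm (sum (outside (u ⊹ i) (λ x → φ (u ⊹ x)))) (φ (u ⊹ i)) ⟩
    φ (u ⊹ i) + sum (outside (u ⊹ i) (λ x → φ (u ⊹ x)))
      ≡⟨ sym (sum-outside-⊹ u i (λ x → φ (u ⊹ x)) i∉u) ⟩
    sum (λ x → create x φ u) ∎
    where open ≡-Reasoning

  triples : Fin n → Fin n → Fin n → ℤ
  triples a b c = sum (tuple φ a b c)

  exchange-quad : ∀ a b c d {v} → Distinct₃ a b c → d ∉ₛ triple a b c → v ≡ quad a b c d →
    sum (outside v (λ x → φ (v ∖ d ⊹ x))) + φ v ≡ triples a b c
  exchange-quad a b c d abc d∉ refl = trans (exchange-at (triple a b c) d d∉)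
    (sum-cong-≗ (λ x → sym (create-triple (create x φ) abc)))

  -- Each of the four points can be exchanged for itself; the summand 4 φ adds these trivial
  -- exchanges, so that the exchanges of one point become all vertices through the remaining triple.
  nbrSum-quad : ∀ a b c d → Distinct₄ a b c d →
    nbrSum φ (quad a b c d) + + 4 * φ (quad a b c d)
      ≡ triples b c d + triples a c d + triples a b d + triples a b c
  nbrSum-quad a b c d dist@((ab , ac , bc) , ad , bd , cd) = begin
    nbrSum φ v + + 4 * φ v
      ≡⟨ cong (_+ + 4 * φ v) (nbrSum-exchange v φ (∣quad∣ dist)) ⟩
    sum (within v ψ) + + 4 * φ v
      ≡⟨ cong (_+ + 4 * φ v) split ⟩
    (ψ d + (ψ c + (ψ b + (ψ a + 0ℤ)))) + + 4 * φ v
      ≡⟨ spread (ψ a) (ψ b) (ψ c) (ψ d) (φ v) ⟩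
    (ψ a + φ v) + (ψ b + φ v) + (ψ c + φ v) + (ψ d + φ v)
      ≡⟨ cong₂ _+_ (cong₂ _+_ (cong₂ _+_
          (exchange-quad b c d a (bc , bd , cd) (∉-triple (≢-sym ab) (≢-sym ac) (≢-sym ad)) to-a)
          (exchange-quad a c d b (ac , ad , cd) (∉-triple ab (≢-sym bc) (≢-sym bd)) to-b))
          (exchange-quad a b d c (ab , ad , bd) (∉-triple ac bc (≢-sym cd)) to-c))
          (exchange-quad a b c d (ab , ac , bc) (∉-triple ad bd cd) refl) ⟩
    triples b c d + triples a c d + triples a b d + triples a b c ∎
    where
    open ≡-Reasoning
    v = quad a b c d
    ψ : Fin n → ℤ
    ψ i = sum (outside v (λ x → φ (v ∖ i ⊹ x)))
    spread : ∀ a b c d e → (d + (c + (b + (a + 0ℤ)))) + + 4 * e ≡ (a + e) + (b + e) + (c + e) + (d + e)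
    spread = solve-∀
    to-c : v ≡ quad a b d c
    to-c = ⊹-comm (⊥ ⊹ a ⊹ b) c d
    to-b : v ≡ quad a c d b
    to-b = trans (cong (_⊹ d) (⊹-comm (⊥ ⊹ a) b c)) (⊹-comm (⊥ ⊹ a ⊹ c) b d)
    to-a : v ≡ quad b c d a
    to-a = trans (cong (λ s → s ⊹ c ⊹ d) (⊹-comm ⊥ a b))
      (trans (cong (_⊹ d) (⊹-comm (⊥ ⊹ b) a c)) (⊹-comm (⊥ ⊹ b ⊹ c) a d))
    split : sum (within v ψ) ≡ ψ d + (ψ c + (ψ b + (ψ a + 0ℤ)))
    split = trans (sum-within-⊹ (triple a b c) d ψ (∉-triple ad bd cd)) (cong (λ z → ψ d + z)
      (trans (sum-within-⊹ (⊥ ⊹ a ⊹ b) c ψ (∉-⊹ {s = ⊥ ⊹ a} bc (∉-⊹ {s = ⊥} ac (∉-⊥ {x = c})))) (cong (λ z → ψ c + z)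
      (trans (sum-within-⊹ (⊥ ⊹ a) b ψ (∉-⊹ {s = ⊥} ab (∉-⊥ {x = b}))) (cong (λ z → ψ b + z)
      (trans (sum-within-⊹ ⊥ a ψ (∉-⊥ {x = a})) (cong (λ z → ψ a + z) (sum-within-⊥ ψ))))))))

-- Sums over the complement of a few points

∑ₗ-↭ : ∀ {A : Set} {xs ys : List A} (φ : A → ℤ) → xs ↭ ys → ∑ₗ xs φ ≡ ∑ₗ ys φ
∑ₗ-↭ φ _↭_.refl          = refl
∑ₗ-↭ φ (_↭_.prep x p)    = cong (λ z → φ x + z) (∑ₗ-↭ φ p)
∑ₗ-↭ φ (_↭_.swap x y p)  = trans (cong (λ z → φ x + (φ y + z)) (∑ₗ-↭ φ p)) (exchange (φ x) (φ y) _)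
  where
  exchange : ∀ a b c → a + (b + c) ≡ b + (a + c)
  exchange = solve-∀
∑ₗ-↭ φ (_↭_.trans p q)   = trans (∑ₗ-↭ φ p) (∑ₗ-↭ φ q)

AllPairs-↭ : ∀ {A : Set} {R : A → A → Set} → (∀ {x y} → R x y → R y x) →
  ∀ {xs ys} → xs ↭ ys → AllPairs R xs → AllPairs R ys
AllPairs-↭ {A} {R} R-sym p = AllPairs-resp-↭ (setoid A) R-sym (resp₂ R) (↭⇒↭ₛ p)

AllPairs-++⁻ : ∀ {A : Set} {R : A → A → Set} xs {ys} → AllPairs R (xs ++ ys) →
  All (λ x → All (R x) ys) xs × AllPairs R ys
AllPairs-++⁻ []       rs       = [] , rs
AllPairs-++⁻ (x ∷ xs) (r ∷ rs) = All.++⁻ʳ xs r ∷ proj₁ (AllPairs-++⁻ xs rs) , proj₂ (AllPairs-++⁻ xs rs)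

sum-∑ₗ-tabulate : ∀ {A : Set} {n} (f : Fin n → A) (k : A → ℤ) → ∑ₗ (tabulate f) k ≡ sum (k ∘ f)
sum-∑ₗ-tabulate {n = zero}  f k = refl
sum-∑ₗ-tabulate {n = suc n} f k = cong (λ z → k (f zero) + z) (sum-∑ₗ-tabulate (f ∘ suc) k)

record Complement {n} (xs : List (Fin n)) : Set where
  field
    others   : List (Fin n)
    ↭-allFin : xs ++ others ↭ allFin n

  distinct : AllPairs _≢_ (xs ++ others)
  distinct = AllPairs-↭ ≢-sym (↭-sym ↭-allFin) (allFin⁺ n)

  others-distinct : AllPairs _≢_ others
  others-distinct = proj₂ (AllPairs-++⁻ xs distinct)

  others-avoid : All (λ y → All (_≢ y) xs) others
  others-avoid = All.All-swap (proj₁ (AllPairs-++⁻ xs distinct))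

  sum-split : ∀ k → sum k ≡ ∑ₗ xs k + ∑ₗ others k
  sum-split k = trans (sym (sum-∑ₗ-tabulate (λ i → i) k))
    (trans (∑ₗ-↭ k (↭-sym ↭-allFin)) (∑ₗ-++ xs others k))

  length-split : length xs ℕ.+ length others ≡ n
  length-split = trans (sym (length-++ xs)) (trans (↭-length ↭-allFin) (length-tabulate (λ i → i)))

complement : ∀ {n} (xs : List (Fin n)) → AllPairs _≢_ xs → Complement xs
complement {n} []       _          = record { others = allFin n ; ↭-allFin = ↭-refl }
complement {n} (x ∷ xs) (x∉ ∷ uniq) with complement xs uniq
... | record { others = ys ; ↭-allFin = p }
  with ∈-++⁻ xs (∈-resp-↭ (↭-sym p) (∈-allFin x))
... | inj₁ x∈xs = ⊥-elim (All.lookup x∉ x∈xs refl)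
... | inj₂ x∈ys with ∈-∃++ x∈ys
... | us , vs , refl = record
  { others   = us ++ vs
  ; ↭-allFin = ↭-trans (↭-sym (↭-trans (++⁺ˡ xs (↭-shift x us vs)) (↭-shift x xs (us ++ vs)))) p }

∑ₗ-cong-All : ∀ {A : Set} {g h : A → ℤ} {xs} → All (λ x → g x ≡ h x) xs → ∑ₗ xs g ≡ ∑ₗ xs h
∑ₗ-cong-All []       = refl
∑ₗ-cong-All (e ∷ es) = cong₂ _+_ e (∑ₗ-cong-All es)

-- Eigenvalue equations hold for distinct points only, whereas `triples`, `pairs` and row sums run
-- over all of `Fin n`. This allows an equation to be summed over everything, with the terms at the
-- excluded points xs corrected on both sides.
sum-agree : ∀ {n} (xs : List (Fin n)) → AllPairs _≢_ xs → (g h : Fin n → ℤ) →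
  (∀ a → All (_≢ a) xs → g a ≡ h a) → sum g + ∑ₗ xs h ≡ sum h + ∑ₗ xs g
sum-agree xs uniq g h g≡h = begin
  sum g + ∑ₗ xs h                           ≡⟨ cong (_+ ∑ₗ xs h) (sum-split g) ⟩
  (∑ₗ xs g + ∑ₗ others g) + ∑ₗ xs h         ≡⟨ cong (λ z → (∑ₗ xs g + z) + ∑ₗ xs h) (∑ₗ-cong-All (All.map (λ {a} → g≡h a) others-avoid)) ⟩
  (∑ₗ xs g + ∑ₗ others h) + ∑ₗ xs h         ≡⟨ rearrange (∑ₗ xs g) (∑ₗ others h) (∑ₗ xs h) ⟩
  (∑ₗ xs h + ∑ₗ others h) + ∑ₗ xs g         ≡⟨ cong (_+ ∑ₗ xs g) (sym (sum-split h)) ⟩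
  sum h + ∑ₗ xs g                           ∎
  where
  open ≡-Reasoning
  open Complement (complement xs uniq)
  rearrange : ∀ a b c → (a + b) + c ≡ (c + b) + a
  rearrange = solve-∀

sum-const : ∀ n t → sum {n} (λ _ → t) ≡ + n * t
sum-const zero    t = refl
sum-const (suc n) t = trans (cong (λ z → t + z) (sum-const n t)) (sym (ℤ.suc-* (+ n) t))

sum-neg : ∀ {n} (f : Fin n → ℤ) → sum (λ i → - f i) ≡ - sum f
sum-neg {zero}  f = refl
sum-neg {suc n} f = trans (cong (λ z → - f zero + z) (sum-neg (f ∘ suc))) (sym (ℤ.neg-distrib-+ (f zero) _))

sum-* : ∀ {n} c (f : Fin n → ℤ) → sum (λ i → c * f i) ≡ c * sum f
sum-* c f = sym (*-distribˡ-sum c f)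

-- Every factor to be cancelled is brought to the form n - k with k < n, literals being written as
-- `+ 2 - + 0`, so that a comparison in ℕ shows it to be nonzero.
cancel : ∀ {n k x} → k < n → (+ n - + k) * x ≡ 0ℤ → x ≡ 0ℤ
cancel {n} {k} k<n e with ℤ.i*j≡0⇒i≡0∨j≡0 (+ n - + k) e
... | inj₂ x≡0 = x≡0
... | inj₁ n-k≡0 = ⊥-elim (ℕ.<-irrefl (sym (ℤ.+-injective (ℤ.i-j≡0⇒i≡j (+ n) (+ k) n-k≡0))) k<n)

double-cancel : ∀ {x} → x + x ≡ 0ℤ → x ≡ 0ℤ
double-cancel {x} e = cancel {2} {0} (s≤s z≤n) (trans (two x) e)
  where
  two : ∀ x → (+ 2 - + 0) * x ≡ x + x
  two = solve-∀

sum-zero : ∀ {n} {f : Fin n → ℤ} → (∀ i → f i ≡ 0ℤ) → sum f ≡ 0ℤ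
sum-zero {n} e = trans (sum-cong-≗ e) (sum-replicate-zero n)

-- The usual partner of `sum-agree`: a ring identity, mostly called `shape`, writes the wanted
-- expression as the difference of the two sides of a known equation. The explicit `0ℤ` in those
-- identities are the vanishing terms at the excluded points.
difference : ∀ {x y z} → x ≡ y → z ≡ x - y → z ≡ 0ℤ
difference x≡y e = trans e (ℤ.i≡j⇒i-j≡0 x≡y)

-- P is a weighting of the edges of the complete graph on n points, and `Q` consists of its weighted
-- degrees.
module Pairs {n} (8≤n : 8 ≤ n) (P : Fin n → Fin n → ℤ)
  (P-sym : ∀ a b → P a b ≡ P b a) (P-diag : ∀ a → P a a ≡ 0ℤ) where

  N : ℤ
  N = + n

  Q : Fin n → ℤ
  Q a = sum (P a)

  sum-P : ∀ a → sum (λ b → P b a) ≡ Q a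
  sum-P a = sum-cong-≗ (λ b → P-sym b a)

  below : ∀ {k} → k < 8 → k < n
  below k<8 = ℕ.≤-trans k<8 8≤n

  -- Summed over d ≠ c the hypothesis gives (n - 2) Q c + S = 0 with S the sum of all degrees;
  -- summed over c as well it gives 2(n - 1) S = 0.
  opposite-Q⇒Q≡0 : (∀ c d → c ≢ d → Q c + Q d ≡ 0ℤ) → ∀ c → Q c ≡ 0ℤ
  opposite-Q⇒Q≡0 opp c = cancel {k = 2} (below (s≤s (s≤s (s≤s z≤n))))
    (difference (row c) (trans (sub (Q c)) (cong (λ z → (N * Q c + z) - (Q c + Q c)) (sym S≡0))))
    where
    S = sum Q
    row : ∀ c → N * Q c + S ≡ Q c + Q c
    row c = begin
      N * Q c + S                       ≡⟨ cong (_+ S) (sym (sum-const n (Q c))) ⟩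
      sum {n} (λ _ → Q c) + S               ≡⟨ sym (∑-distrib-+ (λ _ → Q c) Q) ⟩
      sum (λ d → Q c + Q d)             ≡⟨ sym (ℤ.+-identityʳ _) ⟩
      sum (λ d → Q c + Q d) + 0ℤ        ≡⟨ sum-agree (c ∷ []) ([] ∷ []) (λ d → Q c + Q d) (λ _ → 0ℤ) (λ { d (c≢d ∷ []) → opp c d c≢d }) ⟩
      sum {n} (λ _ → 0ℤ) + (Q c + Q c + 0ℤ) ≡⟨ cong₂ (λ u w → u + w) (sum-zero {n} (λ _ → refl)) (ℤ.+-identityʳ (Q c + Q c)) ⟩
      0ℤ + (Q c + Q c)                  ≡⟨ ℤ.+-identityˡ _ ⟩
      Q c + Q c                         ∎
      where open ≡-Reasoning
    total : N * S + N * S ≡ S + S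
    total = trans (cong₂ _+_ (sym (sum-* N Q)) (sym (sum-const n S)))
      (trans (sym (∑-distrib-+ (λ c → N * Q c) (λ _ → S))) (trans (sum-cong-≗ row) (∑-distrib-+ Q Q)))
    fold : ∀ N S → (N - + 1) * S + (N - + 1) * S ≡ (N * S + N * S) - (S + S)
    fold = solve-∀
    S≡0 : S ≡ 0ℤ
    S≡0 = cancel {k = 1} (below (s≤s (s≤s z≤n))) (double-cancel (difference total (fold N S)))
    sub : ∀ q → (N - + 2) * q ≡ (N * q + 0ℤ) - (q + q)
    sub q = lemma N q
      where
      lemma : ∀ N q → (N - + 2) * q ≡ (N * q + 0ℤ) - (q + q)
      lemma = solve-∀

  -- This is the injectivity of the map that sends a function on pairs to its sums over triangles.
  -- Summing over one, two and three points gives relations that yield S = 0, then Q = 0, then P =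
  -- 0.
  triangles⇒P≡0 : (∀ a b c → Distinct₃ a b c → P b c + P a c + P a b ≡ 0ℤ) → ∀ a b → P a b ≡ 0ℤ
  triangles⇒P≡0 tri a b with a ≟ b
  ... | yes refl = P-diag a
  ... | no  a≢b  = cancel {k = 4} (below (s≤s (s≤s (s≤s (s≤s (s≤s z≤n))))))
    (trans (collect N (P a b) (Q a) (Q b)) (trans (cong₂ (λ x y → x - (y + Q b)) (pair a b a≢b) (Q≡0 a))
      (cong (λ z → 0ℤ - (0ℤ + z)) (Q≡0 b))))
    where
    collect : ∀ N p q r → (N - + 4) * p ≡ (((N - + 4) * p + (q + r)) - (q + r))
    collect = solve-∀
    -- The triangles on c and d are summed over the third point b; the excluded b = c and b = d
    -- carry 2 P c d each, hence n - 4.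
    pair : ∀ c d → c ≢ d → (N - + 4) * P c d + (Q c + Q d) ≡ 0ℤ
    pair c d c≢d = difference eq (shape N (P c d) (Q c) (Q d))
      where
      shape : ∀ N p q r → (N - + 4) * p + (q + r) ≡ ((N * p + r + q) + (0ℤ + (0ℤ + 0ℤ))) - (0ℤ + ((p + p) + ((p + p) + 0ℤ)))
      shape = solve-∀
      g : Fin n → ℤ
      g b = P c d + P b d + P b c
      sum-g : sum g ≡ N * P c d + Q d + Q c
      sum-g = trans (∑-distrib-+ (λ b → P c d + P b d) (λ b → P b c)) (cong₂ _+_
        (trans (∑-distrib-+ (λ _ → P c d) (λ b → P b d)) (cong₂ _+_ (sum-const n (P c d)) (sum-P d))) (sum-P c))
      g-c : g c ≡ P c d + P c d
      g-c = trans (cong (λ z → P c d + P c d + z) (P-diag c)) (ℤ.+-identityʳ _)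
      g-d : g d ≡ P c d + P c d
      g-d = trans (cong₂ (λ y z → P c d + y + z) (P-diag d) (P-sym d c)) (cong (_+ P c d) (ℤ.+-identityʳ (P c d)))
      eq : (N * P c d + Q d + Q c) + (0ℤ + (0ℤ + 0ℤ)) ≡ 0ℤ + ((P c d + P c d) + ((P c d + P c d) + 0ℤ))
      eq = subst₂ _≡_ (cong (_+ 0ℤ) sum-g) (cong₂ (λ x y → x + y) (sum-zero {n} (λ _ → refl)) (cong₂ (λ x y → x + (y + 0ℤ)) g-c g-d))
        (sum-agree (c ∷ d ∷ []) ((c≢d ∷ []) ∷ [] ∷ []) g (λ _ → 0ℤ)
          (λ { b (c≢b ∷ d≢b ∷ []) → tri b c d (≢-sym c≢b , ≢-sym d≢b , c≢d) }))
    S = sum Q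
    row : ∀ c → ((N - + 4) * Q c + (N * Q c + S)) + (0ℤ + 0ℤ) ≡ 0ℤ + ((Q c + Q c) + 0ℤ)
    row c = subst₂ _≡_ (cong (_+ 0ℤ) sum-g) (cong₂ (λ x y → x + (y + 0ℤ)) (sum-zero {n} (λ _ → refl))
        (trans (cong (_+ (Q c + Q c)) (trans (cong ((N - + 4) *_) (P-diag c)) (ℤ.*-zeroʳ (N - + 4))))
          (ℤ.+-identityˡ (Q c + Q c))))
      (sum-agree (c ∷ []) ([] ∷ []) g (λ _ → 0ℤ) (λ { d (c≢d ∷ []) → pair c d c≢d }))
      where
      g : Fin n → ℤ
      g d = (N - + 4) * P c d + (Q c + Q d)
      sum-g : sum g ≡ (N - + 4) * Q c + (N * Q c + S)
      sum-g = trans (∑-distrib-+ (λ d → (N - + 4) * P c d) (λ d → Q c + Q d)) (cong₂ _+_ (sum-* (N - + 4) (P c))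
        (trans (∑-distrib-+ (λ _ → Q c) Q) (cong (_+ S) (sum-const n (Q c)))))
    row′ : ∀ c → ((N - + 3) * Q c + (N - + 3) * Q c) + S ≡ 0ℤ
    row′ c = difference (row c) (shape N (Q c) S)
      where
      shape : ∀ N q S → ((N - + 3) * q + (N - + 3) * q) + S ≡ (((N - + 4) * q + (N * q + S)) + (0ℤ + 0ℤ)) - (0ℤ + ((q + q) + 0ℤ))
      shape = solve-∀
    total : ((N - + 3) * S + (N - + 3) * S) + N * S ≡ 0ℤ
    total = trans (cong₂ _+_ (cong₂ _+_ (sym (sum-* (N - + 3) Q)) (sym (sum-* (N - + 3) Q))) (sym (sum-const n S)))
      (trans (cong (_+ sum {n} (λ _ → S)) (sym (∑-distrib-+ (λ c → (N - + 3) * Q c) (λ c → (N - + 3) * Q c))))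
      (trans (sym (∑-distrib-+ (λ c → (N - + 3) * Q c + (N - + 3) * Q c) (λ _ → S))) (sum-zero row′)))
    S≡0 : S ≡ 0ℤ
    S≡0 = cancel {k = 2} (below (s≤s (s≤s (s≤s z≤n)))) (cancel {3} {0} (s≤s z≤n) (trans (shape N S) total))
      where
      shape : ∀ N S → (+ 3 - + 0) * ((N - + 2) * S) ≡ ((N - + 3) * S + (N - + 3) * S) + N * S
      shape = solve-∀
    Q≡0 : ∀ c → Q c ≡ 0ℤ
    Q≡0 c = cancel {k = 3} (below (s≤s (s≤s (s≤s (s≤s z≤n))))) (double-cancel
      (trans (sym (ℤ.+-identityʳ _)) (trans (cong (λ z → (N - + 3) * Q c + (N - + 3) * Q c + z) (sym S≡0)) (row′ c))))

  ΔΔ : (x y z w : Fin n) → ℤ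
  ΔΔ x y z w = P x z - P y z - P x w + P y w

  -- For fixed x and y the difference P x z - P y z does not depend on z outside {x, y}. Its values
  -- at z = x and z = y cancel and the degrees vanish, so it is 0. Hence each column is constant off
  -- the diagonal, and its zero sum makes it vanish.
  flat⇒P≡0 : (∀ a → Q a ≡ 0ℤ) → (∀ x y z w → Distinct₄ x y z w → ΔΔ x y z w ≡ 0ℤ) → ∀ a b → P a b ≡ 0ℤ
  flat⇒P≡0 Q≡0 flat x z with x ≟ z
  ... | yes refl = P-diag x
  ... | no  x≢z  = cancel {k = 1} (below (s≤s (s≤s z≤n)))
        (difference eq (shape N (P x z)))
    where
    same-column : ∀ y → Distinct₃ x y z → P x z - P y z ≡ 0ℤ
    same-column y (x≢y , x≢z , y≢z) = cancel {k = 2} (below (s≤s (s≤s (s≤s z≤n))))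
      (difference eq (shape N (P x z) (P y z) (P x y)))
      where
      shape : ∀ N p q r → (N - + 2) * (p - q) ≡
        ((N * (p - q) + - 0ℤ + 0ℤ) + (0ℤ + (0ℤ + (0ℤ + 0ℤ))))
          - (0ℤ + ((p - q - 0ℤ + r) + ((p - q - r + 0ℤ) + ((p - q - p + q) + 0ℤ))))
      shape = solve-∀
      g : Fin n → ℤ
      g w = P x z - P y z - P x w + P y w
      sum-g : sum g ≡ N * (P x z - P y z) + - 0ℤ + 0ℤ
      sum-g = trans (∑-distrib-+ (λ w → P x z - P y z - P x w) (P y)) (cong₂ _+_
        (trans (∑-distrib-+ (λ _ → P x z - P y z) (λ w → - P x w)) (cong₂ _+_ (sum-const n (P x z - P y z))
          (trans (sum-neg (P x)) (cong -_ (Q≡0 x))))) (Q≡0 y))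
      eq : (N * (P x z - P y z) + - 0ℤ + 0ℤ) + (0ℤ + (0ℤ + (0ℤ + 0ℤ))) ≡
        0ℤ + ((P x z - P y z - 0ℤ + P x y) + ((P x z - P y z - P x y + 0ℤ) + ((P x z - P y z - P x z + P y z) + 0ℤ)))
      eq = subst₂ _≡_ (cong (_+ 0ℤ) sum-g) (cong₂ _+_ (sum-zero {n} (λ _ → refl)) (cong₂ _+_
            (cong₂ (λ u v → P x z - P y z - u + v) (P-diag x) (P-sym y x))
            (cong (λ u → (P x z - P y z - P x y + u) + ((P x z - P y z - P x z + P y z) + 0ℤ)) (P-diag y))))
        (sum-agree (x ∷ y ∷ z ∷ []) ((x≢y ∷ x≢z ∷ []) ∷ (y≢z ∷ []) ∷ [] ∷ []) g (λ _ → 0ℤ)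
          (λ { w (x≢w ∷ y≢w ∷ z≢w ∷ []) → flat x y z w ((x≢y , x≢z , y≢z) , x≢w , y≢w , z≢w) }))
    shape : ∀ N p → (N - + 1) * p ≡ ((N * p + - 0ℤ) + (0ℤ + (0ℤ + 0ℤ))) - (0ℤ + ((p - p) + ((p - 0ℤ) + 0ℤ)))
    shape = solve-∀
    g : Fin n → ℤ
    g y = P x z - P y z
    sum-g : sum g ≡ N * P x z + - 0ℤ
    sum-g = trans (∑-distrib-+ (λ _ → P x z) (λ y → - P y z)) (cong₂ _+_ (sum-const n (P x z))
          (trans (sum-neg (λ y → P y z)) (cong -_ (trans (sum-P z) (Q≡0 z)))))
    eq : (N * P x z + - 0ℤ) + (0ℤ + (0ℤ + 0ℤ)) ≡ 0ℤ + ((P x z - P x z) + ((P x z - 0ℤ) + 0ℤ))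
    eq = subst₂ _≡_ (cong (_+ 0ℤ) sum-g) (cong₂ _+_ (sum-zero {n} (λ _ → refl))
          (cong (λ u → (P x z - P x z) + ((P x z - u) + 0ℤ)) (P-diag z)))
        (sum-agree (x ∷ z ∷ []) ((x≢z ∷ []) ∷ [] ∷ []) g (λ _ → 0ℤ)
          (λ { y (x≢y ∷ z≢y ∷ []) → same-column y (x≢y , x≢z , ≢-sym z≢y) }))

module _ {n} (φ : Subset n → ℤ) where

  tuple-repeat₂₃ : ∀ a b d → tuple φ a b b d ≡ 0ℤ
  tuple-repeat₂₃ a b d = create-zero a (create-twice b (create d φ)) ⊥

  tuple-repeat₃₄ : ∀ a b c → tuple φ a b c c ≡ 0ℤ
  tuple-repeat₃₄ a b c = create-zero a (create-zero b (create-twice c φ)) ⊥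

  tuple-rotate : ∀ a b c d → tuple φ a b c d ≡ tuple φ b c d a
  tuple-rotate a b c d =
    trans (tuple-swap₁₂ φ a b c d) (trans (tuple-swap₂₃ φ b a c d) (tuple-swap₃₄ φ b c a d))

  triples-swap₁₂ : ∀ a b c → triples φ a b c ≡ triples φ b a c
  triples-swap₁₂ a b c = sum-cong-≗ (tuple-swap₁₂ φ a b c)

  triples-swap₂₃ : ∀ a b c → triples φ a b c ≡ triples φ a c b
  triples-swap₂₃ a b c = sum-cong-≗ (tuple-swap₂₃ φ a b c)

  triples-repeat₁₂ : ∀ a c → triples φ a a c ≡ 0ℤ
  triples-repeat₁₂ a c = sum-zero {f = tuple φ a a c} (tuple-repeat φ a c)

  triples-repeat₁₃ : ∀ a b → triples φ a b a ≡ 0ℤ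
  triples-repeat₁₃ a b = trans (triples-swap₂₃ a b a) (triples-repeat₁₂ a b)

  triples-rotate : ∀ a b c → triples φ a b c ≡ triples φ b c a
  triples-rotate a b c = trans (triples-swap₁₂ a b c) (triples-swap₂₃ b a c)

  -- The two free points are ordered, so for a ≠ b every vertex through a and b is counted twice;
  -- `Q` accordingly counts every vertex through a point six times.
  pairs : Fin n → Fin n → ℤ
  pairs a b = sum (triples φ a b)

  pairs-sym : ∀ a b → pairs a b ≡ pairs b a
  pairs-sym a b = sum-cong-≗ (triples-swap₁₂ a b)

  pairs-diag : ∀ a → pairs a a ≡ 0ℤ
  pairs-diag a = sum-zero {f = triples φ a a} (triples-repeat₁₂ a)

-- Eigenfunctions of J(n,4)

-- μ is the eigenvalue of A + 4, that is, the eigenvalue of the graph increased by 4.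
module Eigenfunction {n} (8≤n : 8 ≤ n) (φ : Subset n → ℤ) (μ : ℤ)
  (eigen : ∀ v → IsVertex v → nbrSum φ v + + 4 * φ v ≡ μ * φ v) where

  F = tuple φ
  T = triples φ
  P = pairs φ
  open Pairs 8≤n P (pairs-sym φ) (pairs-diag φ) public

  eigen-tuple : ∀ a b c d → Distinct₄ a b c d → T b c d + T a c d + T a b d + T a b c ≡ μ * F a b c d
  eigen-tuple a b c d dist = trans (sym (nbrSum-quad φ a b c d dist))
    (trans (eigen (quad a b c d) (∣quad∣ dist)) (cong (μ *_) (sym (tuple-quad φ dist))))

  -- `eigen-tuple` is summed over its first point a. The excluded values a = b, c, d contribute 2 T
  -- b c d each, which turns N into N - 6.
  triples-pairs : ∀ b c d → Distinct₃ b c d →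
    (N - + 6 - μ) * T b c d + (P c d + P b d + P b c) ≡ 0ℤ
  triples-pairs b c d (b≢c , b≢d , c≢d) = difference eq (shape N μ (T b c d) (P c d) (P b d) (P b c))
    where
    t = T b c d
    shape : ∀ N μ t p q r → (N - + 6 - μ) * t + (p + q + r) ≡
      ((N * t + p + q + r) + (μ * 0ℤ + (μ * 0ℤ + (μ * 0ℤ + 0ℤ))))
        - (μ * t + ((t + t + 0ℤ + 0ℤ) + ((t + 0ℤ + t + 0ℤ) + ((t + 0ℤ + 0ℤ + t) + 0ℤ))))
    shape = solve-∀
    g h : Fin n → ℤ
    g a = T b c d + T a c d + T a b d + T a b c
    h a = μ * F a b c d
    to-last : ∀ x y → sum (λ a → T a x y) ≡ P x y
    to-last x y = sum-cong-≗ (λ a → triples-rotate φ a x y)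
    sum-g : sum g ≡ N * t + P c d + P b d + P b c
    sum-g = trans (∑-distrib-+ (λ a → t + T a c d + T a b d) (λ a → T a b c)) (cong₂ _+_
      (trans (∑-distrib-+ (λ a → t + T a c d) (λ a → T a b d)) (cong₂ _+_
        (trans (∑-distrib-+ (λ _ → t) (λ a → T a c d)) (cong₂ _+_ (sum-const n t) (to-last c d)))
        (to-last b d))) (to-last b c))
    sum-h : sum h ≡ μ * t
    sum-h = trans (sum-* μ (λ a → F a b c d)) (cong (μ *_) (sum-cong-≗ (λ a → tuple-rotate φ a b c d)))
    g-b : g b ≡ t + t + 0ℤ + 0ℤ
    g-b = cong₂ (λ x y → t + t + x + y) (triples-repeat₁₂ φ b d) (triples-repeat₁₂ φ b c)
    g-c : g c ≡ t + 0ℤ + t + 0ℤ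
    g-c = trans (cong₂ (λ x y → t + x + y + T c b c) (triples-repeat₁₂ φ c d) (triples-swap₁₂ φ c b d))
      (cong (λ x → t + 0ℤ + t + x) (triples-repeat₁₃ φ c b))
    g-d : g d ≡ t + 0ℤ + 0ℤ + t
    g-d = trans (cong₂ (λ x y → t + x + y + T d b c) (triples-repeat₁₃ φ d c) (triples-repeat₁₃ φ d b))
      (cong (λ x → t + 0ℤ + 0ℤ + x) (triples-rotate φ d b c))
    h-b : h b ≡ μ * 0ℤ
    h-b = cong (μ *_) (tuple-repeat φ b c d)
    h-c : h c ≡ μ * 0ℤ
    h-c = cong (μ *_) (trans (tuple-swap₁₂ φ c b c d) (tuple-repeat₂₃ φ b c d))
    h-d : h d ≡ μ * 0ℤ
    h-d = cong (μ *_) (trans (tuple-rotate φ d b c d) (tuple-repeat₃₄ φ b c d))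
    eq : (N * t + P c d + P b d + P b c) + (μ * 0ℤ + (μ * 0ℤ + (μ * 0ℤ + 0ℤ))) ≡
      μ * t + ((t + t + 0ℤ + 0ℤ) + ((t + 0ℤ + t + 0ℤ) + ((t + 0ℤ + 0ℤ + t) + 0ℤ)))
    eq = subst₂ _≡_
      (cong₂ _+_ sum-g (cong₂ _+_ h-b (cong₂ _+_ h-c (cong (_+ 0ℤ) h-d))))
      (cong₂ _+_ sum-h (cong₂ _+_ g-b (cong₂ _+_ g-c (cong (_+ 0ℤ) g-d))))
      (sum-agree (b ∷ c ∷ d ∷ []) ((b≢c ∷ b≢d ∷ []) ∷ (c≢d ∷ []) ∷ [] ∷ []) g h
        (λ { a (b≢a ∷ c≢a ∷ d≢a ∷ []) →
          eigen-tuple a b c d ((≢-sym b≢a , ≢-sym c≢a , b≢c) , ≢-sym d≢a , b≢d , c≢d) }))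

  F-second-difference : (s t x y z w : Fin n) → ℤ
  F-second-difference s t x y z w = F s t x z - F s t y z - F s t x w + F s t y w

-- 2n - 10 is θ₂ + 4. For this μ the coefficient in `triples-pairs` is -(n - 4), so the pair sums
-- determine the triple sums and thereby the function.
module Eigenfunction₂ {n} (8≤n : 8 ≤ n) (φ : Subset n → ℤ)
  (eigen : ∀ v → IsVertex v → nbrSum φ v + + 4 * φ v ≡ (+ 2 * + n - + 10) * φ v) where

  open Eigenfunction 8≤n φ (+ 2 * + n - + 10) eigen public

  triples-from-pairs : ∀ b c d → Distinct₃ b c d → (N - + 4) * T b c d ≡ P c d + P b d + P b c
  triples-from-pairs b c d dist = sym (ℤ.i-j≡0⇒i≡j _ _
    (trans (shape N (T b c d) (P c d + P b d + P b c)) (triples-pairs b c d dist)))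
    where
    shape : ∀ N t p → p - (N - + 4) * t ≡ (N - + 6 - (+ 2 * N - + 10)) * t + p
    shape = solve-∀

  -- When the relation between triples and pairs is summed over one point, both sides contain (n -
  -- 4) P c d and only Q c + Q d is left.
  Q≡0 : ∀ a → Q a ≡ 0ℤ
  Q≡0 = opposite-Q⇒Q≡0 opposite
    where
    opposite : ∀ c d → c ≢ d → Q c + Q d ≡ 0ℤ
    opposite c d c≢d = difference eq (shape N (P c d) (Q c) (Q d))
      where
      p = P c d
      shape : ∀ N p q r → q + r ≡ ((N * p + r + q) + ((N - + 4) * 0ℤ + ((N - + 4) * 0ℤ + 0ℤ)))
        - ((N - + 4) * p + ((p + p + 0ℤ) + ((p + 0ℤ + p) + 0ℤ)))
      shape = solve-∀
      g h : Fin n → ℤ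
      g b = P c d + P b d + P b c
      h b = (N - + 4) * T b c d
      eq : (N * p + Q d + Q c) + ((N - + 4) * 0ℤ + ((N - + 4) * 0ℤ + 0ℤ)) ≡
        (N - + 4) * p + ((p + p + 0ℤ) + ((p + 0ℤ + p) + 0ℤ))
      eq = subst₂ _≡_
        (cong₂ _+_
          (trans (∑-distrib-+ (λ b → P c d + P b d) (λ b → P b c)) (cong₂ _+_
            (trans (∑-distrib-+ (λ _ → P c d) (λ b → P b d)) (cong₂ _+_ (sum-const n p) (sum-P d))) (sum-P c)))
          (cong₂ _+_ (cong ((N - + 4) *_) (triples-repeat₁₂ φ c d))
            (cong (_+ 0ℤ) (cong ((N - + 4) *_) (triples-repeat₁₃ φ d c)))))
        (cong₂ _+_
          (trans (sum-* (N - + 4) (λ b → T b c d)) (cong ((N - + 4) *_) (sum-cong-≗ (λ b → triples-rotate φ b c d))))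
          (cong₂ _+_ (cong (λ z → p + p + z) (pairs-diag φ c))
            (cong (_+ 0ℤ) (cong₂ (λ y z → p + y + z) (pairs-diag φ d) (pairs-sym φ d c)))))
        (sum-agree (c ∷ d ∷ []) ((c≢d ∷ []) ∷ [] ∷ []) g h
          (λ { b (c≢b ∷ d≢b ∷ []) → sym (triples-from-pairs b c d (≢-sym c≢b , ≢-sym d≢b , c≢d)) }))

  -- Each of the six pairs lies in two of the four triples, hence the factor 2.
  tuple-from-pairs : ∀ a b c d → Distinct₄ a b c d → (N - + 4) * ((+ 2 * N - + 10) * F a b c d) ≡
    + 2 * (P a b + P a c + P a d + P b c + P b d + P c d)
  tuple-from-pairs a b c d dist@((ab , ac , bc) , ad , bd , cd) = begin
    K * ((+ 2 * N - + 10) * F a b c d)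
      ≡⟨ cong (K *_) (sym (eigen-tuple a b c d dist)) ⟩
    K * (T b c d + T a c d + T a b d + T a b c)
      ≡⟨ spread K (T b c d) (T a c d) (T a b d) (T a b c) ⟩
    K * T b c d + K * T a c d + K * T a b d + K * T a b c
      ≡⟨ cong₂ _+_ (cong₂ _+_ (cong₂ _+_ (triples-from-pairs b c d (bc , bd , cd)) (triples-from-pairs a c d (ac , ad , cd)))
           (triples-from-pairs a b d (ab , ad , bd))) (triples-from-pairs a b c (ab , ac , bc)) ⟩
    (P c d + P b d + P b c) + (P c d + P a d + P a c) + (P b d + P a d + P a b) + (P b c + P a c + P a b)
      ≡⟨ collect (P a b) (P a c) (P a d) (P b c) (P b d) (P c d) ⟩
    + 2 * (P a b + P a c + P a d + P b c + P b d + P c d) ∎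
    where
    open ≡-Reasoning
    K = N - + 4
    spread : ∀ k a b c d → k * (a + b + c + d) ≡ k * a + k * b + k * c + k * d
    spread = solve-∀
    collect : ∀ a b c d e f → (f + e + d) + (f + c + b) + (e + c + a) + (d + b + a) ≡ + 2 * (a + b + c + d + e + f)
    collect = solve-∀

  P≡0⇒φ≡0 : (∀ a b → P a b ≡ 0ℤ) → ∀ v → IsVertex v → φ v ≡ 0ℤ
  P≡0⇒φ≡0 P≡0 v ∣v∣ with vertex⇒quad v ∣v∣
  ... | a , b , c , d , dist , refl = trans (sym (tuple-quad φ dist))
    (cancel {k = 5} (below (s≤s (s≤s (s≤s (s≤s (s≤s (s≤s z≤n)))))))
    (cancel {k = 4} (below (s≤s (s≤s (s≤s (s≤s (s≤s z≤n))))))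
    (cancel {2} {0} (s≤s z≤n) (trans (shape N (F a b c d)) (trans (tuple-from-pairs a b c d dist) zeros)))))
    where
    shape : ∀ N f → (+ 2 - + 0) * ((N - + 4) * ((N - + 5) * f)) ≡ (N - + 4) * ((+ 2 * N - + 10) * f)
    shape = solve-∀
    zeros : + 2 * (P a b + P a c + P a d + P b c + P b d + P c d) ≡ 0ℤ
    zeros rewrite P≡0 a b | P≡0 a c | P≡0 a d | P≡0 b c | P≡0 b d | P≡0 c d = refl

  -- In the four expansions by `tuple-from-pairs` the pair s t and all pairs joining s or t to x, y,
  -- z or w occur with both signs. What survives is 2 `ΔΔ`, which does not involve s and t.
  flat-tuple⇒flat : ∀ s t x y z w →
    Distinct₄ s t x z → Distinct₄ s t y z → Distinct₄ s t x w → Distinct₄ s t y w →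
    F-second-difference s t x y z w ≡ 0ℤ → ΔΔ x y z w ≡ 0ℤ
  flat-tuple⇒flat s t x y z w xz yz xw yw flat = cancel {2} {0} (s≤s z≤n) (begin
    (+ 2 - + 0) * ΔΔ x y z w
      ≡⟨ shape (P s t) (P s x) (P s y) (P s z) (P s w) (P t x) (P t y) (P t z) (P t w) (P x z) (P y z) (P x w) (P y w) ⟩
    R x z - R y z - R x w + R y w
      ≡⟨ cong₂ _+_ (cong₂ _-_ (cong₂ _-_ (R-F xz) (R-F yz)) (R-F xw)) (R-F yw) ⟩
    L x z - L y z - L x w + L y w
      ≡⟨ collect (N - + 4) (+ 2 * N - + 10) (F s t x z) (F s t y z) (F s t x w) (F s t y w) ⟩
    (N - + 4) * ((+ 2 * N - + 10) * F-second-difference s t x y z w)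
      ≡⟨ cong (λ f → (N - + 4) * ((+ 2 * N - + 10) * f)) flat ⟩
    (N - + 4) * ((+ 2 * N - + 10) * 0ℤ)
      ≡⟨ zero′ (N - + 4) (+ 2 * N - + 10) ⟩
    0ℤ ∎)
    where
    open ≡-Reasoning
    L R : Fin n → Fin n → ℤ
    L c d = (N - + 4) * ((+ 2 * N - + 10) * F s t c d)
    R c d = + 2 * (P s t + P s c + P s d + P t c + P t d + P c d)
    R-F : ∀ {c d} → Distinct₄ s t c d → R c d ≡ L c d
    R-F {c} {d} dist = sym (tuple-from-pairs s t c d dist)
    zero′ : ∀ a b → a * (b * 0ℤ) ≡ 0ℤ
    zero′ = solve-∀
    collect : ∀ k m a b c d → k * (m * a) - k * (m * b) - k * (m * c) + k * (m * d) ≡ k * (m * (a - b - c + d))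
    collect = solve-∀
    shape : ∀ st sx sy sz sw tx ty tz tw xz yz xw yw → (+ 2 - + 0) * (xz - yz - xw + yw) ≡
      + 2 * (st + sx + sz + tx + tz + xz) - + 2 * (st + sy + sz + ty + tz + yz)
        - + 2 * (st + sx + sw + tx + tw + xw) + + 2 * (st + sy + sw + ty + tw + yw)
    shape = solve-∀

module Eigenfunction₃ {n} (8≤n : 8 ≤ n) (φ : Subset n → ℤ)
  (eigen : ∀ v → IsVertex v → nbrSum φ v + + 4 * φ v ≡ (+ n - + 6) * φ v) where

  open Eigenfunction 8≤n φ (+ n - + 6) eigen public

  -- n - 6 is θ₃ + 4, and for this μ the coefficient of T in `triples-pairs` is zero, which leaves
  -- the bare triangle relations.
  P≡0 : ∀ a b → P a b ≡ 0ℤ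
  P≡0 = triangles⇒P≡0 (λ a b c dist → trans (shape N (T a b c) (P b c + P a c + P a b)) (triples-pairs a b c dist))
    where
    shape : ∀ N t p → p ≡ (N - + 6 - (N - + 6)) * t + p
    shape = solve-∀

  module _ (x y z w : Fin n) where

    -- For the function g this is (n - 6)(3n - 6) a(s), where a(s) + a(t) is the second difference
    -- of 1_D; in this scaling it is an integer without division.
    τ : Fin n → ℤ
    τ s = T s x z - T s y z - T s x w + T s y w

    -- In the signed sum of the four eigenvalue equations the triples through both s and t cancel;
    -- those through exactly one of them make up τ s and τ t.
    second-difference-τ : ∀ s t → Distinct₄ s t x z → Distinct₄ s t y z → Distinct₄ s t x w → Distinct₄ s t y w →
      τ s + τ t ≡ (N - + 6) * F-second-difference s t x y z w
    second-difference-τ s t xz yz xw yw = begin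
      τ s + τ t
        ≡⟨ shape (T s x z) (T s y z) (T s x w) (T s y w) (T t x z) (T t y z) (T t x w) (T t y w) (T s t x) (T s t y) (T s t z) (T s t w) ⟩
      L x z - L y z - L x w + L y w
        ≡⟨ cong₂ _+_ (cong₂ _-_ (cong₂ _-_ (eigen-tuple s t x z xz) (eigen-tuple s t y z yz)) (eigen-tuple s t x w xw)) (eigen-tuple s t y w yw) ⟩
      (N - + 6) * F s t x z - (N - + 6) * F s t y z - (N - + 6) * F s t x w + (N - + 6) * F s t y w
        ≡⟨ collect (N - + 6) (F s t x z) (F s t y z) (F s t x w) (F s t y w) ⟩
      (N - + 6) * F-second-difference s t x y z w ∎
      where
      open ≡-Reasoning
      L : Fin n → Fin n → ℤ
      L c d = T t c d + T s c d + T s t d + T s t c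
      collect : ∀ m a b c d → m * a - m * b - m * c + m * d ≡ m * (a - b - c + d)
      collect = solve-∀
      shape : ∀ sxz syz sxw syw txz tyz txw tyw stx sty stz stw →
        (sxz - syz - sxw + syw) + (txz - tyz - txw + tyw) ≡
          (txz + sxz + stz + stx) - (tyz + syz + stz + sty) - (txw + sxw + stw + stx) + (tyw + syw + stw + sty)
      shape = solve-∀

    sum-τ : sum τ ≡ 0ℤ
    sum-τ = trans (∑-distrib-+ (λ s → T s x z - T s y z - T s x w) (λ s → T s y w)) (trans (cong₂ _+_
      (trans (∑-distrib-+ (λ s → T s x z - T s y z) (λ s → - T s x w)) (cong₂ _+_
        (trans (∑-distrib-+ (λ s → T s x z) (λ s → - T s y z)) (cong₂ _+_ (col x z)
          (trans (sum-neg (λ s → T s y z)) (cong -_ (col y z)))))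
        (trans (sum-neg (λ s → T s x w)) (cong -_ (col x w)))))
      (col y w)) refl)
      where
      col : ∀ a b → sum (λ s → T s a b) ≡ 0ℤ
      col a b = trans (sum-cong-≗ (λ s → triples-rotate φ s a b)) (P≡0 a b)

    -- This passes from the sum over all points to the sum over the n - 4 points outside the
    -- corners. At a corner the repeated points remove half of the terms, and the remaining triple
    -- sums cancel between corners.
    sum-τ-corners : τ x + (τ y + (τ z + (τ w + 0ℤ))) ≡ 0ℤ
    sum-τ-corners = trans (cong₂ _+_ τ-x (cong₂ _+_ τ-y (cong₂ _+_ τ-z (cong (_+ 0ℤ) τ-w))))
      (shape (T x y z) (T x y w) (T x z w) (T y z w))
      where
      shape : ∀ a b c d → (0ℤ - a - 0ℤ + b) + ((a - 0ℤ - b + 0ℤ) + ((0ℤ - 0ℤ - c + d) + ((c - d - 0ℤ + 0ℤ) + 0ℤ))) ≡ 0ℤ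
      shape = solve-∀
      quadr : ∀ {a a′ b b′ c c′ d d′ : ℤ} → a ≡ a′ → b ≡ b′ → c ≡ c′ → d ≡ d′ → a - b - c + d ≡ a′ - b′ - c′ + d′
      quadr refl refl refl refl = refl
      τ-x : τ x ≡ 0ℤ - T x y z - 0ℤ + T x y w
      τ-x = quadr (triples-repeat₁₂ φ x z) refl (triples-repeat₁₂ φ x w) refl
      τ-y : τ y ≡ T x y z - 0ℤ - T x y w + 0ℤ
      τ-y = quadr (triples-swap₁₂ φ y x z) (triples-repeat₁₂ φ y z) (triples-swap₁₂ φ y x w) (triples-repeat₁₂ φ y w)
      τ-z : τ z ≡ 0ℤ - 0ℤ - T x z w + T y z w
      τ-z = quadr (triples-repeat₁₃ φ z x) (triples-repeat₁₃ φ z y) (triples-swap₁₂ φ z x w) (triples-swap₁₂ φ z y w)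
      τ-w : τ w ≡ T x z w - T y z w - 0ℤ + 0ℤ
      τ-w = quadr (triples-rotate φ w x z) (triples-rotate φ w y z) (triples-repeat₁₃ φ w x) (triples-repeat₁₃ φ w y)

nonneg+ : ∀ {x y} → 0ℤ ≤ᶻ x → 0ℤ ≤ᶻ y → 0ℤ ≤ᶻ x + y
nonneg+ p q = ℤ.+-mono-≤ p q

pos+ : ∀ {x y} → 0ℤ ≤ᶻ x → 0ℤ <ᶻ y → 0ℤ <ᶻ x + y
pos+ p q = ℤ.+-mono-≤-< p q

not-pos : ∀ {x} → 0ℤ <ᶻ x → ¬ (x ≡ 0ℤ)
not-pos p refl = ℤ.<-irrefl refl p

∑-map-neg : ∀ xs → ∑ₗ (map -_ xs) (λ x → x) ≡ - ∑ₗ xs (λ x → x)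
∑-map-neg []       = refl
∑-map-neg (x ∷ xs) = trans (cong (λ z → - x + z) (∑-map-neg xs)) (sym (ℤ.neg-distrib-+ x _))

∑-nonneg : ∀ {xs} → All (0ℤ ≤ᶻ_) xs → 0ℤ ≤ᶻ ∑ₗ xs (λ x → x)
∑-nonneg []       = ℤ.≤-refl
∑-nonneg (p ∷ ps) = nonneg+ p (∑-nonneg ps)

find : ∀ {A : Set} {P Q : A → Set} → (∀ x → P x ⊎ Q x) → ∀ xs →
  All Q xs ⊎ (∃₂ λ x ys → xs ↭ x ∷ ys × P x)
find P∣Q []       = inj₁ []
find P∣Q (x ∷ xs) with P∣Q x
... | inj₁ Px = inj₂ (x , xs , ↭-refl , Px)
... | inj₂ Qx with find P∣Q xs
... | inj₁ Qxs                = inj₁ (Qx ∷ Qxs)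
... | inj₂ (y , ys , p , Py)  = inj₂ (y , x ∷ ys , ↭-trans (_↭_.prep x p) (_↭_.swap x y ↭-refl) , Py)

-- Numbers whose pair sums are ±K or ±2K

module SmallPairSums {K : ℤ} (0<K : 0ℤ <ᶻ K) where

  data Small (v : ℤ) : Set where
    +one : v ≡ K → Small v
    +two : v ≡ K + K → Small v
    -one : v ≡ - K → Small v
    -two : v ≡ - (K + K) → Small v

  SmallSum : ℤ → ℤ → Set
  SmallSum x y = Small (x + y)

  Small-neg : ∀ {v} → Small v → Small (- v)
  Small-neg (+one refl) = -one refl
  Small-neg (+two refl) = -two refl
  Small-neg (-one refl) = +one (ℤ.neg-involutive K)
  Small-neg (-two refl) = +two (ℤ.neg-involutive (K + K))

  SmallSum-sym : ∀ {x y} → SmallSum x y → SmallSum y x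
  SmallSum-sym {x} {y} = subst Small (ℤ.+-comm x y)

  SmallSum-neg : ∀ {x y} → SmallSum x y → SmallSum (- x) (- y)
  SmallSum-neg {x} {y} s = subst Small (ℤ.neg-distrib-+ x y) (Small-neg s)

  0≤K : 0ℤ ≤ᶻ K
  0≤K = ℤ.<⇒≤ 0<K

  upper : ∀ {v} → Small v → 0ℤ ≤ᶻ K + K - v
  upper (+one refl) = subst (0ℤ ≤ᶻ_) (e K) 0≤K
    where e : ∀ K → K ≡ K + K - K
          e = solve-∀
  upper (+two refl) = ℤ.≤-reflexive (e K)
    where e : ∀ K → 0ℤ ≡ K + K - (K + K)
          e = solve-∀
  upper (-one refl) = subst (0ℤ ≤ᶻ_) (e K) (nonneg+ (nonneg+ 0≤K 0≤K) 0≤K)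
    where e : ∀ K → K + K + K ≡ K + K - (- K)
          e = solve-∀
  upper (-two refl) = subst (0ℤ ≤ᶻ_) (e K) (nonneg+ (nonneg+ 0≤K 0≤K) (nonneg+ 0≤K 0≤K))
    where e : ∀ K → K + K + (K + K) ≡ K + K - (- (K + K))
          e = solve-∀

  lower : ∀ {v} → Small v → 0ℤ ≤ᶻ K + K + v
  lower {v} s = subst (λ u → 0ℤ ≤ᶻ K + K + u) (ℤ.neg-involutive v) (upper (Small-neg s))

  dichotomy : ∀ {v} → Small v → 0ℤ ≤ᶻ v - K ⊎ 0ℤ ≤ᶻ - K - v
  dichotomy (+one refl) = inj₁ (ℤ.≤-reflexive (sym (ℤ.+-inverseʳ K)))
  dichotomy (+two refl) = inj₁ (subst (0ℤ ≤ᶻ_) (e K) 0≤K)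
    where e : ∀ K → K ≡ K + K - K
          e = solve-∀
  dichotomy (-one refl) = inj₂ (ℤ.≤-reflexive (sym (ℤ.+-inverseʳ (- K))))
  dichotomy (-two refl) = inj₂ (subst (0ℤ ≤ᶻ_) (e K) 0≤K)
    where e : ∀ K → K ≡ - K - (- (K + K))
          e = solve-∀

  at-least : ∀ {v} → 0ℤ ≤ᶻ v → Small v → 0ℤ ≤ᶻ v - K
  at-least {v} 0≤v s with dichotomy s
  ... | inj₁ p = p
  ... | inj₂ p = ⊥-elim (not-pos (pos+ (nonneg+ 0≤v p) 0<K) (e v K))
    where e : ∀ v K → v + (- K - v) + K ≡ 0ℤ
          e = solve-∀

  -- Otherwise a + z ≥ K. If also a′ + z ≥ K, then a + a′ ≥ 2K - 2z > 2K. If a′ + z ≤ -K, then a -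
  -- a′ ≥ 2K, and a + a′ ≤ 2K forces a′ ≤ 0.
  two-positive : ∀ {a a′ z} → 0ℤ <ᶻ a′ → 0ℤ <ᶻ - z →
    SmallSum a a′ → SmallSum a z → SmallSum a′ z → 0ℤ ≤ᶻ - K - (a + z)
  two-positive {a} {a′} {z} 0<a′ 0<-z aa′ az a′z with dichotomy az
  ... | inj₂ p = p
  ... | inj₁ p with dichotomy a′z
  ... | inj₁ q = ⊥-elim (not-pos (pos+ (nonneg+ (nonneg+ p q) (nonneg+ (upper aa′) (ℤ.<⇒≤ 0<-z))) 0<-z) (e a a′ z K))
    where e : ∀ a a′ z K → ((a + z - K) + (a′ + z - K)) + ((K + K - (a + a′)) + - z) + - z ≡ 0ℤ
          e = solve-∀
  ... | inj₂ q = ⊥-elim (not-pos (pos+ (nonneg+ (nonneg+ p q) (nonneg+ (upper aa′) (ℤ.<⇒≤ 0<a′))) 0<a′) (e a a′ z K))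
    where e : ∀ a a′ z K → ((a + z - K) + (- K - (a′ + z))) + ((K + K - (a + a′)) + a′) + a′ ≡ 0ℤ
          e = solve-∀

  -- `two-positive` gives a + z ≤ -K, and for the negated numbers, with the roles of the signs
  -- exchanged, a + z ≥ K.
  two-and-two : ∀ {a a′ z z′} → 0ℤ <ᶻ a → 0ℤ <ᶻ a′ → z <ᶻ 0ℤ → z′ <ᶻ 0ℤ →
    SmallSum a a′ → SmallSum z z′ → SmallSum a z → SmallSum a′ z → SmallSum a z′ → Empty
  two-and-two {a} {a′} {z} {z′} 0<a 0<a′ z<0 z′<0 aa′ zz′ az a′z az′ =
    not-pos (pos+ (nonneg+ below above) (pos+ 0≤K 0<K)) (e a z K)
    where
    below = two-positive {a} 0<a′ (ℤ.neg-mono-< z<0) aa′ az a′z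
    above : 0ℤ ≤ᶻ - K - (- z + - a)
    above = two-positive { - z} (ℤ.neg-mono-< z′<0) (subst (0ℤ <ᶻ_) (sym (ℤ.neg-involutive a)) 0<a)
      (SmallSum-neg {z} {z′} zz′) (SmallSum-neg {z} {a} (SmallSum-sym {a} az)) (SmallSum-neg {z′} {a} (SmallSum-sym {a} az′))
    e : ∀ a z K → (- K - (a + z)) + (- K - (- z + - a)) + (K + K) ≡ 0ℤ
    e = solve-∀

  -- The pair sums are nonnegative and small, hence at least K, so a + b + c ≥ 3K/2. Among the
  -- possible values of -v only 2K is that large.
  triple-sum : ∀ {a b c v} → 0ℤ ≤ᶻ a → 0ℤ ≤ᶻ b → 0ℤ ≤ᶻ c →
    SmallSum a b → SmallSum a c → SmallSum b c → Small v → v + (a + b + c) ≡ 0ℤ → a + b + c ≡ K + K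
  triple-sum {a} {b} {c} {v} pa pb pc ab ac bc s total = go s
    where
    sums : 0ℤ ≤ᶻ (a + b - K) + (a + c - K) + (b + c - K)
    sums = nonneg+ (nonneg+ (at-least (nonneg+ pa pb) ab) (at-least (nonneg+ pa pc) ac)) (at-least (nonneg+ pb pc) bc)
    go : Small v → a + b + c ≡ K + K
    go (+one refl) = ⊥-elim (not-pos (pos+ (nonneg+ (nonneg+ pa pb) pc) 0<K) (trans (ℤ.+-comm (a + b + c) K) total))
    go (+two refl) = ⊥-elim (not-pos (pos+ (nonneg+ (nonneg+ pa pb) pc) (pos+ 0≤K 0<K)) (trans (ℤ.+-comm (a + b + c) (K + K)) total))
    go (-one refl) = ⊥-elim (not-pos (pos+ sums 0<K) (trans (e a b c K) (cong₂ _+_ total total)))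
      where e : ∀ a b c K → (a + b - K) + (a + c - K) + (b + c - K) + K ≡ (- K + (a + b + c)) + (- K + (a + b + c))
            e = solve-∀
    go (-two refl) = ℤ.i-j≡0⇒i≡j (a + b + c) (K + K) (trans (ℤ.+-comm (a + b + c) (- (K + K))) total)

  -- The five pair sums around the cycle a b c d f give a + b + c + d + f ≥ 5K/2, which z + y ≥ -2K
  -- cannot balance.
  five-cycle : ∀ z y a b c d f r → 0ℤ ≤ᶻ K + K + (z + y) →
    0ℤ ≤ᶻ a + b - K → 0ℤ ≤ᶻ b + c - K → 0ℤ ≤ᶻ c + d - K → 0ℤ ≤ᶻ d + f - K → 0ℤ ≤ᶻ a + f - K → 0ℤ ≤ᶻ r →
    ¬ (z + (y + (a + (b + (c + (d + (f + r)))))) ≡ 0ℤ)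
  five-cycle z y a b c d f r zy ab bc cd df af rest total =
    not-pos (pos+ (nonneg+ (nonneg+ (nonneg+ zy zy) (nonneg+ (nonneg+ (nonneg+ (nonneg+ ab bc) cd) df) af)) (nonneg+ rest rest)) 0<K)
      (trans (e z y a b c d f r K) (cong (λ u → u + u) total))
    where
    e : ∀ z y a b c d f r K →
      ((K + K + (z + y)) + (K + K + (z + y)) +
        ((a + b - K) + (b + c - K) + (c + d - K) + (d + f - K) + (a + f - K))) + (r + r) + K
      ≡ (z + (y + (a + (b + (c + (d + (f + r))))))) + (z + (y + (a + (b + (c + (d + (f + r)))))))
    e = solve-∀

  -- Sizes 4 and 6 have to be left out: the numbers -2K, 0, K, K, and for even K the number -5K/2
  -- with five copies of K/2, have small pair sums and total 0.
  Size : ℕ → Set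
  Size m = m ≡ 5 ⊎ 7 ≤ m

  -- Only z may be negative. With four others, any three of them sum to 2K by `triple-sum`, so all
  -- equal 2K/3, and their pair sum 4K/3 is not small. With six or more others, five of them
  -- outweigh z and a sixth by `five-cycle`.
  lonely : ∀ z ys → Size (suc (length ys)) → All (0ℤ ≤ᶻ_) ys → AllPairs SmallSum (z ∷ ys) →
    ¬ (∑ₗ (z ∷ ys) (λ x → x) ≡ 0ℤ)
  lonely z (a ∷ b ∷ c ∷ d ∷ []) (inj₁ _) (pa ∷ pb ∷ pc ∷ pd ∷ [])
    ((za ∷ zb ∷ zc ∷ zd ∷ []) ∷ (ab ∷ ac ∷ ad ∷ []) ∷ (bc ∷ bd ∷ []) ∷ (cd ∷ []) ∷ [] ∷ []) total = finish ab
    where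
    bcd = triple-sum pb pc pd bc bd cd za (trans (e z a b c d) total)
      where e : ∀ z a b c d → z + a + (b + c + d) ≡ z + (a + (b + (c + (d + 0ℤ))))
            e = solve-∀
    acd = triple-sum pa pc pd ac ad cd zb (trans (e z a b c d) total)
      where e : ∀ z a b c d → z + b + (a + c + d) ≡ z + (a + (b + (c + (d + 0ℤ))))
            e = solve-∀
    abd = triple-sum pa pb pd ab ad bd zc (trans (e z a b c d) total)
      where e : ∀ z a b c d → z + c + (a + b + d) ≡ z + (a + (b + (c + (d + 0ℤ))))
            e = solve-∀
    abc = triple-sum pa pb pc ab ac bc zd (trans (e z a b c d) total)
      where e : ∀ z a b c d → z + d + (a + b + c) ≡ z + (a + (b + (c + (d + 0ℤ))))
            e = solve-∀
    three : (a + b) + (a + b) + (a + b) ≡ K + K + (K + K)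
    three = ℤ.i-j≡0⇒i≡j _ _ (begin
      (a + b) + (a + b) + (a + b) - (K + K + (K + K))
        ≡⟨ e a b c d K ⟩
      (a + b + c - (K + K)) + (a + b + c - (K + K)) + (a + b + d - (K + K)) + (a + b + d - (K + K))
        - (b + c + d - (K + K)) - (a + c + d - (K + K))
        ≡⟨ vanish (ℤ.i≡j⇒i-j≡0 abc) (ℤ.i≡j⇒i-j≡0 abd) (ℤ.i≡j⇒i-j≡0 bcd) (ℤ.i≡j⇒i-j≡0 acd) ⟩
      0ℤ ∎)
      where
      open ≡-Reasoning
      vanish : ∀ {p q r s} → p ≡ 0ℤ → q ≡ 0ℤ → r ≡ 0ℤ → s ≡ 0ℤ → p + p + q + q - r - s ≡ 0ℤ
      vanish refl refl refl refl = refl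
      e : ∀ a b c d K → (a + b) + (a + b) + (a + b) - (K + K + (K + K)) ≡
        (a + b + c - (K + K)) + (a + b + c - (K + K)) + (a + b + d - (K + K)) + (a + b + d - (K + K))
          - (b + c + d - (K + K)) - (a + c + d - (K + K))
      e = solve-∀
    contra : ∀ v → a + b ≡ v → v + v + v ≡ K + K + (K + K)
    contra v refl = three
    finish : ¬ Small (a + b)
    finish (+one e) = not-pos 0<K (trans (shape K) (ℤ.i≡j⇒i-j≡0 (sym (contra K e))))
      where shape : ∀ K → K ≡ K + K + (K + K) - (K + K + K)
            shape = solve-∀
    finish (+two e) = not-pos (pos+ 0≤K 0<K) (trans (shape K) (ℤ.i≡j⇒i-j≡0 (contra (K + K) e)))
      where shape : ∀ K → K + K ≡ (K + K) + (K + K) + (K + K) - (K + K + (K + K))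
            shape = solve-∀
    finish (-one e) = not-pos (pos+ (nonneg+ pa pb) 0<K) (trans (cong (_+ K) e) (ℤ.+-inverseˡ K))
    finish (-two e) = not-pos (pos+ (nonneg+ pa pb) (pos+ 0≤K 0<K)) (trans (cong (_+ (K + K)) e) (ℤ.+-inverseˡ (K + K)))
  lonely z (y ∷ a ∷ b ∷ c ∷ d ∷ f ∷ ys) _ (_ ∷ pa ∷ pb ∷ pc ∷ pd ∷ pf ∷ ps)
    ((zy ∷ _) ∷ _ ∷ (ab ∷ _ ∷ _ ∷ af ∷ _) ∷ (bc ∷ _) ∷ (cd ∷ _) ∷ (df ∷ _) ∷ _) =
    five-cycle z y a b c d f (∑ₗ ys (λ x → x)) (lower zy) (at-least (nonneg+ pa pb) ab) (at-least (nonneg+ pb pc) bc) (at-least (nonneg+ pc pd) cd)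
      (at-least (nonneg+ pd pf) df) (at-least (nonneg+ pa pf) af) (∑-nonneg ps)
  lonely z []                        (inj₁ ())
  lonely z (_ ∷ [])                  (inj₁ ())
  lonely z (_ ∷ _ ∷ [])              (inj₁ ())
  lonely z (_ ∷ _ ∷ _ ∷ [])          (inj₁ ())
  lonely z (_ ∷ _ ∷ _ ∷ _ ∷ _ ∷ [])  (inj₁ ())
  lonely z []                        (inj₂ (s≤s ()))
  lonely z (_ ∷ [])                  (inj₂ (s≤s (s≤s ())))
  lonely z (_ ∷ _ ∷ [])              (inj₂ (s≤s (s≤s (s≤s ()))))
  lonely z (_ ∷ _ ∷ _ ∷ [])          (inj₂ (s≤s (s≤s (s≤s (s≤s ())))))
  lonely z (_ ∷ _ ∷ _ ∷ _ ∷ [])      (inj₂ (s≤s (s≤s (s≤s (s≤s (s≤s ()))))))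
  lonely z (_ ∷ _ ∷ _ ∷ _ ∷ _ ∷ [])  (inj₂ (s≤s (s≤s (s≤s (s≤s (s≤s (s≤s ())))))))

  lonely⁻ : ∀ z ys → Size (suc (length ys)) → All (_≤ᶻ 0ℤ) ys → AllPairs SmallSum (z ∷ ys) →
    ¬ (∑ₗ (z ∷ ys) (λ x → x) ≡ 0ℤ)
  lonely⁻ z ys size ps small total = lonely (- z) (map -_ ys)
    (subst (Size ∘ suc) (sym (length-map -_ ys)) size)
    (All.map⁺ (All.map ℤ.neg-mono-≤ ps))
    (AllPairs.map⁺ {f = -_} (AllPairs.map (λ {x} {y} → SmallSum-neg {x} {y}) small))
    (trans (∑-map-neg (z ∷ ys)) (cong -_ total))

  negative? : ∀ x → x <ᶻ 0ℤ ⊎ 0ℤ ≤ᶻ x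
  negative? x with 0ℤ ℤ.≤? x
  ... | yes p = inj₂ p
  ... | no ¬p = inj₁ (ℤ.≰⇒> ¬p)

  positive? : ∀ x → 0ℤ <ᶻ x ⊎ x ≤ᶻ 0ℤ
  positive? x with x ℤ.≤? 0ℤ
  ... | yes p = inj₂ p
  ... | no ¬p = inj₁ (ℤ.≰⇒> ¬p)

  -- Two negative and two positive entries contradict `two-and-two`. Otherwise all entries but one
  -- have the same weak sign, and `lonely` or its mirror image applies after a permutation.
  no-small-pair-sums : ∀ zs → Size (length zs) → AllPairs SmallSum zs → ¬ (∑ₗ zs (λ x → x) ≡ 0ℤ)
  no-small-pair-sums []        (inj₁ ())
  no-small-pair-sums []        (inj₂ ())
  no-small-pair-sums zs@(z₀ ∷ zs₀) size small total = search
    where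
    module _ {ys} (p : zs ↭ ys) where
      size′ : Size (length ys)
      size′ = subst Size (↭-length p) size
      small′ : AllPairs SmallSum ys
      small′ = AllPairs-↭ (λ {x} {y} → SmallSum-sym {x} {y}) p small
      total′ : ∑ₗ ys (λ x → x) ≡ 0ℤ
      total′ = trans (sym (∑ₗ-↭ (λ x → x) p)) total
    search : Empty
    search with find negative? zs
    ... | inj₁ (_ ∷ ps) = lonely z₀ zs₀ size ps small total
    ... | inj₂ (z , ws , p , z<0) with find negative? ws
    ... | inj₁ ps = lonely z ws (size′ p) ps (small′ p) (total′ p)
    ... | inj₂ (z′ , us , q , z′<0) with find positive? us
    ... | inj₁ ns = lonely⁻ z (z′ ∷ us) (size′ pq) (ℤ.<⇒≤ z′<0 ∷ ns) (small′ pq) (total′ pq)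
      where pq = ↭-trans p (_↭_.prep z q)
    ... | inj₂ (a , vs , r , 0<a) with find positive? vs
    ... | inj₁ ns = lonely⁻ a (z ∷ z′ ∷ vs) (size′ pqr) (ℤ.<⇒≤ z<0 ∷ ℤ.<⇒≤ z′<0 ∷ ns) (small′ pqr) (total′ pqr)
      where pqr = ↭-trans p (↭-trans (_↭_.prep z (↭-trans q (_↭_.prep z′ r))) (↭-shift a (z ∷ z′ ∷ []) vs))
    ... | inj₂ (a′ , _ , s , 0<a′)
      with small′ (↭-trans p (_↭_.prep z (↭-trans q (_↭_.prep z′ (↭-trans r (_↭_.prep a s))))))
    ... | (zz′ ∷ za ∷ za′ ∷ _) ∷ (z′a ∷ _) ∷ (aa′ ∷ _) ∷ _ =
      two-and-two 0<a 0<a′ z<0 z′<0 aa′ zz′ (SmallSum-sym {z} za) (SmallSum-sym {z} za′) (SmallSum-sym {z′} z′a)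

-- Completely regular codes

χ-∧ : ∀ a b → χ (a ∧ b) ≡ χ a * χ b
χ-∧ true  true  = refl
χ-∧ true  false = refl
χ-∧ false b     = refl

any-true⁺ : ∀ {A : Set} (p : A → Bool) {x xs} → x ∈ xs → p x ≡ true → any p xs ≡ true
any-true⁺ p {xs = y ∷ ys} (here refl) px rewrite px = refl
any-true⁺ p {xs = y ∷ ys} (there x∈) px with p y
... | true  = refl
... | false = any-true⁺ p x∈ px

any-true⁻ : ∀ {A : Set} (p : A → Bool) xs → any p xs ≡ true → ∃ λ x → x ∈ xs × p x ≡ true
any-true⁻ p (x ∷ xs) e with p x in px
... | true  = x , here refl , px
... | false with any-true⁻ p xs e
... | y , y∈ , py = y , there y∈ , py

∈-allSubsets : ∀ {n} (s : Subset n) → s ∈ allSubsets n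
∈-allSubsets []              = here refl
∈-allSubsets (true ∷ s)      = ∈-++⁺ˡ (∈-map⁺ (true ∷_) (∈-allSubsets s))
∈-allSubsets {suc n} (false ∷ s) = ∈-++⁺ʳ (map (true ∷_) (allSubsets n)) (∈-map⁺ (false ∷_) (∈-allSubsets s))

∈-vertices⁺ : ∀ {n} {v : Subset n} → IsVertex v → v ∈ vertices n
∈-vertices⁺ {v = v} ∣v∣ = ∈-filter⁺ (λ s → (∣ s ∣ ≡ᵇ 4) ≟ᵇ true) (∈-allSubsets v) (≡⇒≡ᵇ ∣v∣)

∈-vertices⁻ : ∀ {n} {v : Subset n} → v ∈ vertices n → IsVertex v
∈-vertices⁻ {n} {v} v∈ =
  ≡ᵇ⇒≡ ∣ v ∣ 4 (proj₂ (∈-filter⁻ (λ s → (∣ s ∣ ≡ᵇ 4) ≟ᵇ true) {xs = allSubsets n} v∈))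

adj-sym : ∀ {n} (v w : Subset n) → adj v w ≡ adj w v
adj-sym v w = cong (λ s → ∣ s ∣ ≡ᵇ 3) (∩-comm v w)

∑-vertices-cong : ∀ {n} {φ ψ : Subset n → ℤ} → (∀ v → IsVertex v → φ v ≡ ψ v) →
  ∑ₗ (vertices n) φ ≡ ∑ₗ (vertices n) ψ
∑-vertices-cong e = ∑ₗ-cong-All (All.tabulate (λ {v} v∈ → e v (∈-vertices⁻ v∈)))

sum-within-const : ∀ {n} (s : Subset n) k → sum (within s (λ _ → k)) ≡ + ∣ s ∣ * k
sum-within-const []          k = refl
sum-within-const (true ∷ s)  k = trans (cong₂ _+_ (ℤ.*-identityˡ k) (sum-within-const s k)) (sym (ℤ.suc-* (+ ∣ s ∣) k))
sum-within-const (false ∷ s) k = trans (ℤ.+-identityˡ _) (sum-within-const s k)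

sum-outside-one : ∀ {n} (s : Subset n) → sum (outside s (λ _ → 1ℤ)) ≡ + n - + ∣ s ∣
sum-outside-one []                  = refl
sum-outside-one {suc n} (true ∷ s)  = trans (ℤ.+-identityˡ _) (trans (sum-outside-one s) (e (+ n) (+ ∣ s ∣)))
  where e : ∀ n s → n - s ≡ (+ 1 + n) - (+ 1 + s)
        e = solve-∀
sum-outside-one {suc n} (false ∷ s) = trans (cong (λ z → 1ℤ + z) (sum-outside-one s)) (e (+ n) (+ ∣ s ∣))
  where e : ∀ n s → + 1 + (n - s) ≡ (+ 1 + n) - s
        e = solve-∀

degree : ∀ {n} (v : Subset n) → IsVertex v → nbrSum (λ _ → 1ℤ) v ≡ + 4 * (+ n - + 4)
degree {n} v ∣v∣ = begin
  nbrSum (λ _ → 1ℤ) v                                  ≡⟨ nbrSum-exchange v (λ _ → 1ℤ) ∣v∣ ⟩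
  sum (within v (λ _ → sum (outside v (λ _ → 1ℤ))))    ≡⟨ sum-within-const v (sum (outside v (λ _ → 1ℤ))) ⟩
  + ∣ v ∣ * sum (outside v (λ _ → 1ℤ))                  ≡⟨ cong (+ ∣ v ∣ *_) (sum-outside-one v) ⟩
  + ∣ v ∣ * (+ n - + ∣ v ∣)                             ≡⟨ cong (λ k → + k * (+ n - + k)) ∣v∣ ⟩
  + 4 * (+ n - + 4)                                     ∎
  where open ≡-Reasoning

-- After exchanging the two sums, every φ w is counted once per neighbour of w.
∑-nbrSum : ∀ {n} (φ : Subset n → ℤ) →
  ∑ₗ (vertices n) (nbrSum φ) ≡ (+ 4 * (+ n - + 4)) * ∑ₗ (vertices n) φ
∑-nbrSum {n} φ = begin
  ∑ₗ V (λ v → ∑ₗ V (λ w → χ (adj v w) * φ w))  ≡⟨ ∑ₗ-comm V V (λ v w → χ (adj v w) * φ w) ⟩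
  ∑ₗ V (λ w → ∑ₗ V (λ v → χ (adj v w) * φ w))  ≡⟨ ∑-vertices-cong row ⟩
  ∑ₗ V (λ w → k * φ w)                         ≡⟨ ∑ₗ-distribˡ-* V k φ ⟩
  k * ∑ₗ V φ                                   ∎
  where
  open ≡-Reasoning
  V = vertices n
  k = + 4 * (+ n - + 4)
  row : ∀ w → IsVertex w → ∑ₗ V (λ v → χ (adj v w) * φ w) ≡ k * φ w
  row w ∣w∣ = begin
    ∑ₗ V (λ v → χ (adj v w) * φ w)           ≡⟨ ∑ₗ-cong V (λ v → e v) ⟩
    ∑ₗ V (λ v → φ w * (χ (adj w v) * 1ℤ))    ≡⟨ ∑ₗ-distribˡ-* V (φ w) (λ v → χ (adj w v) * 1ℤ) ⟩
    φ w * nbrSum (λ _ → 1ℤ) w                ≡⟨ cong (φ w *_) (degree w ∣w∣) ⟩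
    φ w * k                                  ≡⟨ ℤ.*-comm (φ w) k ⟩
    k * φ w                                  ∎
    where
    e : ∀ v → χ (adj v w) * φ w ≡ φ w * (χ (adj w v) * 1ℤ)
    e v = trans (cong (λ b → χ b * φ w) (adj-sym v w)) (trans (ℤ.*-comm (χ (adj w v)) (φ w))
      (cong (φ w *_) (sym (ℤ.*-identityʳ (χ (adj w v))))))

nonadjacent : Fin 3 → Fin 3 → Bool
nonadjacent 0F 2F = true
nonadjacent 2F 0F = true
nonadjacent _  _  = false

is : Fin 3 → Fin 3 → ℤ
is i j = χ (does (i ≟ j))

by-class : (h : Fin 3 → ℤ) → ∀ k → h k ≡ h 0F * is k 0F + h 1F * is k 1F + h 2F * is k 2F
by-class h 0F = e (h 0F) (h 1F) (h 2F)
  where e : ∀ a b c → a ≡ a * + 1 + b * + 0 + c * + 0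
        e = solve-∀
by-class h 1F = e (h 0F) (h 1F) (h 2F)
  where e : ∀ a b c → b ≡ a * + 0 + b * + 1 + c * + 0
        e = solve-∀
by-class h 2F = e (h 0F) (h 1F) (h 2F)
  where e : ∀ a b c → c ≡ a * + 0 + b * + 0 + c * + 1
        e = solve-∀

module CompletelyRegular {n} (C : Code n) (α β γ : ℕ → ℕ) (regular : IsCompletelyRegular C 2 α β γ) where

  covered : ∀ v → IsVertex v → atMost C 2 v ≡ true
  covered = proj₂ (proj₁ regular)

  -- On vertices this is the distance to C; the default `2F` is right there because every vertex is
  -- `covered`.
  class : Subset n → Fin 3
  class v = if C v then 0F else (if atMost C 1 v then 1F else 2F)

  layer-class : ∀ v → IsVertex v → ∀ j → layer C (toℕ j) v ≡ does (class v ≟ j)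
  layer-class v ∣v∣ j with C v in c | any (λ w → adj v w ∧ C w) (vertices n) in a | covered v ∣v∣
  layer-class v ∣v∣ 0F | true  | _     | _ = c
  layer-class v ∣v∣ 1F | true  | _     | _ rewrite c = refl
  layer-class v ∣v∣ 2F | true  | _     | _ rewrite c = refl
  layer-class v ∣v∣ 0F | false | true  | _ = c
  layer-class v ∣v∣ 1F | false | true  | _ rewrite c | a = refl
  layer-class v ∣v∣ 2F | false | true  | _ rewrite c | a = refl
  layer-class v ∣v∣ 0F | false | false | _ = c
  layer-class v ∣v∣ 1F | false | false | _ rewrite c | a = refl
  layer-class v ∣v∣ 2F | false | false | e rewrite c | a | e = refl

  class≡0⇒C : ∀ v → class v ≡ 0F → C v ≡ true
  class≡0⇒C v e with C v | atMost C 1 v | e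
  ... | true  | _     | _ = refl
  ... | false | true  | ()
  ... | false | false | ()

  class≡2⇒¬atMost₁ : ∀ v → class v ≡ 2F → atMost C 1 v ≡ false
  class≡2⇒¬atMost₁ v e with C v | any (λ w → adj v w ∧ C w) (vertices n) | e
  ... | true  | _     | ()
  ... | false | true  | ()
  ... | false | false | _ = refl

  near-code : ∀ {v w} → IsVertex w → adj v w ≡ true → C w ≡ true → atMost C 1 v ≡ true
  near-code {v} {w} ∣w∣ vw w∈C with C v
  ... | true  = refl
  ... | false = any-true⁺ (λ u → adj v u ∧ C u) (∈-vertices⁺ ∣w∣) (cong₂ _∧_ vw w∈C)

  adjacent-classes : ∀ v w → IsVertex v → IsVertex w → adj v w ≡ true → nonadjacent (class v) (class w) ≡ false
  adjacent-classes v w ∣v∣ ∣w∣ vw = go (class v) (class w) refl refl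
    where
    go : ∀ i j → class v ≡ i → class w ≡ j → nonadjacent i j ≡ false
    go 0F 2F ei ej = trans (sym (near-code {w} ∣v∣ (trans (adj-sym w v) vw) (class≡0⇒C v ei))) (class≡2⇒¬atMost₁ w ej)
    go 2F 0F ei ej = trans (sym (near-code {v} ∣w∣ vw (class≡0⇒C w ej))) (class≡2⇒¬atMost₁ v ei)
    go 0F 0F _ _ = refl
    go 0F 1F _ _ = refl
    go 1F 0F _ _ = refl
    go 1F 1F _ _ = refl
    go 1F 2F _ _ = refl
    go 2F 1F _ _ = refl
    go 2F 2F _ _ = refl

  nbrs-in-class : ∀ v j → + nbrsIn C (toℕ j) v ≡ nbrSum (λ w → is (class w) j) v
  nbrs-in-class v j = trans (length-filter (λ w → adj v w ∧ layer C (toℕ j) w) (vertices n))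
    (∑-vertices-cong (λ w ∣w∣ → trans (χ-∧ (adj v w) (layer C (toℕ j) w))
      (cong (λ b → χ (adj v w) * χ b) (layer-class w ∣w∣ j))))

  nbrSum-class : ∀ (h : Fin 3 → ℤ) v → nbrSum (λ w → h (class w)) v ≡
    h 0F * + nbrsIn C 0 v + h 1F * + nbrsIn C 1 v + h 2F * + nbrsIn C 2 v
  nbrSum-class h v = begin
    ∑ₗ V (λ w → A w * h (class w))
      ≡⟨ ∑ₗ-cong V (λ w → trans (cong (A w *_) (by-class h (class w)))
           (spread (A w) (h 0F) (h 1F) (h 2F) (is (class w) 0F) (is (class w) 1F) (is (class w) 2F))) ⟩
    ∑ₗ V (λ w → term 0F w + term 1F w + term 2F w)
      ≡⟨ ∑ₗ-distrib-+ V (λ w → term 0F w + term 1F w) (term 2F) ⟩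
    ∑ₗ V (λ w → term 0F w + term 1F w) + ∑ₗ V (term 2F)
      ≡⟨ cong (_+ ∑ₗ V (term 2F)) (∑ₗ-distrib-+ V (term 0F) (term 1F)) ⟩
    ∑ₗ V (term 0F) + ∑ₗ V (term 1F) + ∑ₗ V (term 2F)
      ≡⟨ cong₂ _+_ (cong₂ _+_ (total 0F) (total 1F)) (total 2F) ⟩
    h 0F * + nbrsIn C 0 v + h 1F * + nbrsIn C 1 v + h 2F * + nbrsIn C 2 v ∎
    where
    open ≡-Reasoning
    V = vertices n
    A : Subset n → ℤ
    A w = χ (adj v w)
    term : Fin 3 → Subset n → ℤ
    term j w = h j * (A w * is (class w) j)
    total : ∀ j → ∑ₗ V (term j) ≡ h j * + nbrsIn C (toℕ j) v
    total j = trans (∑ₗ-distribˡ-* V (h j) (λ w → A w * is (class w) j)) (cong (h j *_) (sym (nbrs-in-class v j)))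
    spread : ∀ z a b c x y u → z * (a * x + b * y + c * u) ≡ a * (z * x) + b * (z * y) + c * (z * u)
    spread = solve-∀

  no-nbrs : ∀ v j → IsVertex v → nonadjacent (class v) j ≡ true → + nbrsIn C (toℕ j) v ≡ 0ℤ
  no-nbrs v j ∣v∣ e = trans (nbrs-in-class v j) (trans (∑-vertices-cong zero′) (∑ₗ-zero (vertices n)))
    where
    zero′ : ∀ w → IsVertex w → χ (adj v w) * is (class w) j ≡ 0ℤ
    zero′ w ∣w∣ with adj v w in vw
    ... | false = refl
    ... | true with class w ≟ j
    ... | no _ = refl
    ... | yes refl with trans (sym e) (adjacent-classes v w ∣v∣ ∣w∣ vw)
    ... | ()

  M : Mat3
  M = intersectionMatrix α β γ

  in-layer : ∀ v j → IsVertex v → class v ≡ j → layer C (toℕ j) v ≡ true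
  in-layer v j ∣v∣ refl = trans (layer-class v ∣v∣ j) (does-refl j)
    where
    does-refl : ∀ (j : Fin 3) → does (j ≟ j) ≡ true
    does-refl 0F = refl
    does-refl 1F = refl
    does-refl 2F = refl

  -- Seven entries are the regularity conditions. The two corner zeros come from `no-nbrs`, as C and
  -- C₂ are at distance 2.
  nbrs-matrix : ∀ v k → IsVertex v → class v ≡ k → ∀ j → + nbrsIn C (toℕ j) v ≡ M k j
  nbrs-matrix v k ∣v∣ e j = go k e j
    where
    row : ∀ k → class v ≡ k → (i≤2 : toℕ k ≤ 2) → _
    row k e i≤2 = proj₂ regular (toℕ k) i≤2 v ∣v∣ (in-layer v k ∣v∣ e)
    go : ∀ k → class v ≡ k → ∀ j → + nbrsIn C (toℕ j) v ≡ M k j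
    go 0F e 0F = cong +_ (proj₁ (row 0F e z≤n))
    go 0F e 1F = cong +_ (proj₁ (proj₂ (row 0F e z≤n)))
    go 0F e 2F = no-nbrs v 2F ∣v∣ (cong (λ i → nonadjacent i 2F) e)
    go 1F e 0F = cong +_ (proj₂ (proj₂ (row 1F e (s≤s z≤n))))
    go 1F e 1F = cong +_ (proj₁ (row 1F e (s≤s z≤n)))
    go 1F e 2F = cong +_ (proj₁ (proj₂ (row 1F e (s≤s z≤n))))
    go 2F e 0F = no-nbrs v 0F ∣v∣ (cong (λ i → nonadjacent i 0F) e)
    go 2F e 1F = cong +_ (proj₂ (proj₂ (row 2F e (s≤s (s≤s z≤n)))))
    go 2F e 2F = cong +_ (proj₁ (row 2F e (s≤s (s≤s z≤n))))

  nbrSum-matrix : ∀ (h : Fin 3 → ℤ) v → IsVertex v → nbrSum (λ w → h (class w)) v ≡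
    h 0F * M (class v) 0F + h 1F * M (class v) 1F + h 2F * M (class v) 2F
  nbrSum-matrix h v ∣v∣ = trans (nbrSum-class h v) (cong₂ _+_ (cong₂ _+_ (m 0F) (m 1F)) (m 2F))
    where
    m : ∀ j → h j * + nbrsIn C (toℕ j) v ≡ h j * M (class v) j
    m j = cong (h j *_) (nbrs-matrix v (class v) ∣v∣ refl j)

  -- A right eigenvector of the quotient matrix `M` becomes an eigenfunction of the graph when
  -- pulled back along `class`; 4 is added to match A + 4.
  eigenfunction : ∀ (h : Fin 3 → ℤ) μ →
    (∀ k → h 0F * M k 0F + h 1F * M k 1F + h 2F * M k 2F + + 4 * h k ≡ μ * h k) →
    ∀ v → IsVertex v → nbrSum (λ w → h (class w)) v + + 4 * h (class v) ≡ μ * h (class v)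
  eigenfunction h μ rows v ∣v∣ = trans (cong (_+ + 4 * h (class v)) (nbrSum-matrix h v ∣v∣)) (rows (class v))

  Adjacent : Subset n → Subset n → Set
  Adjacent v w = IsVertex v × IsVertex w × adj v w ≡ true

  towards-code : ∀ k v → atMost C (suc k) v ≡ true → atMost C k v ≡ false →
    ∃ λ w → IsVertex w × adj v w ≡ true × atMost C k w ≡ true
  towards-code k v near far with any-true⁻ (λ w → adj v w ∧ atMost C k w) (vertices n) (∨-resolve near far)
    where
    ∨-resolve : ∀ {a b} → a ∨ b ≡ true → a ≡ false → b ≡ true
    ∨-resolve e refl = e
  ... | w , w∈ , p = w , ∈-vertices⁻ w∈ , ∧-true p
    where
    ∧-true : ∀ {a b} → a ∧ b ≡ true → a ≡ true × b ≡ true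
    ∧-true {true} {true} _ = refl , refl

  C⇒class≡0 : ∀ {w} → C w ≡ true → class w ≡ 0F
  C⇒class≡0 {w} e with C w | e
  ... | true | _ = refl

  atMost₁⇒class≡1 : ∀ {v} → C v ≡ false → atMost C 1 v ≡ true → class v ≡ 1F
  atMost₁⇒class≡1 {v} e e′ with C v | any (λ w → adj v w ∧ C w) (vertices n) | e | e′
  ... | false | true | _ | _ = refl

  layer₂⇒class≡2 : ∀ v → IsVertex v → layer C 2 v ≡ true → class v ≡ 2F
  layer₂⇒class≡2 v ∣v∣ e with class v | trans (sym e) (layer-class v ∣v∣ 2F)
  ... | 2F | _ = refl
  ... | 0F | ()
  ... | 1F | ()

  not-in-code : ∀ {u v} → IsVertex v → adj u v ≡ true → atMost C 1 u ≡ false → C v ≡ false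
  not-in-code {u} {v} ∣v∣ uv u-far with C v in v∈C
  ... | false = refl
  ... | true  = trans (sym (near-code {u} ∣v∣ uv v∈C)) u-far

  -- One walk from C₂ through C₁ to C serves several ends: its vertices show that every layer is
  -- inhabited, and its edges that β₀ and γ₂ are positive.
  Path : Set
  Path = ∃₂ λ u v → ∃ λ w → Adjacent u v × Adjacent v w × class u ≡ 2F × class v ≡ 1F × class w ≡ 0F

  layer-path : Path
  layer-path = from-layer₂ (proj₁ (proj₁ regular))
    where
    from-layer₁ : ∀ {u v} → class u ≡ 2F → Adjacent u v → C v ≡ false → atMost C 1 v ≡ true →
      (∃ λ w → IsVertex w × adj v w ≡ true × C w ≡ true) → Path
    from-layer₁ {u} {v} class-u uv v∉C v-near (w , ∣w∣ , vw , w∈C) =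
      u , v , w , uv , (proj₁ (proj₂ uv) , ∣w∣ , vw) , class-u , atMost₁⇒class≡1 v∉C v-near , C⇒class≡0 w∈C
    step : ∀ {u} → IsVertex u → class u ≡ 2F → (∃ λ v → IsVertex v × adj u v ≡ true × atMost C 1 v ≡ true) → Path
    step {u} ∣u∣ class-u (v , ∣v∣ , uv , v-near) =
      from-layer₁ class-u (∣u∣ , ∣v∣ , uv) v∉C v-near (towards-code 0 v v-near v∉C)
      where
      v∉C : C v ≡ false
      v∉C = not-in-code ∣v∣ uv (class≡2⇒¬atMost₁ u class-u)
    from-layer₂ : (Σ (Subset n) λ u → IsVertex u × layer C 2 u ≡ true) → Path
    from-layer₂ (u , ∣u∣ , u∈C₂) =
      step ∣u∣ class-u (towards-code 1 u (covered u ∣u∣) (class≡2⇒¬atMost₁ u class-u))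
      where
      class-u : class u ≡ 2F
      class-u = layer₂⇒class≡2 u ∣u∣ u∈C₂

  nbrs-positive : ∀ {v w} j → Adjacent v w → class w ≡ j → 0 < nbrsIn C (toℕ j) v
  nbrs-positive {v} {w} j (_ , ∣w∣ , vw) e = nonempty (∈-filter⁺ (λ u → (adj v u ∧ layer C (toℕ j) u) ≟ᵇ true)
    (∈-vertices⁺ ∣w∣) (cong₂ _∧_ vw (in-layer w j ∣w∣ e)))
    where
    nonempty : ∀ {A : Set} {x : A} {xs} → x ∈ xs → 0 < length xs
    nonempty (here _)  = s≤s z≤n
    nonempty (there _) = s≤s z≤n

  inhabited : ∀ k → ∃ λ v → IsVertex v × class v ≡ k
  inhabited = on-path layer-path
    where
    on-path : Path → ∀ k → ∃ λ v → IsVertex v × class v ≡ k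
    on-path (u , v , w , _ , (_ , ∣w∣ , _) , _ , _ , class-w) 0F = w , ∣w∣ , class-w
    on-path (u , v , w , (_ , ∣v∣ , _) , _ , _ , class-v , _) 1F = v , ∣v∣ , class-v
    on-path (u , v , w , (∣u∣ , _) , _ , class-u , _)         2F = u , ∣u∣ , class-u

  row-sum : ∀ k → M k 0F + M k 1F + M k 2F ≡ + 4 * (+ n - + 4)
  row-sum k = at (inhabited k)
    where
    e : ∀ a b c → a + b + c ≡ 1ℤ * a + 1ℤ * b + 1ℤ * c
    e = solve-∀
    at : (∃ λ v → IsVertex v × class v ≡ k) → M k 0F + M k 1F + M k 2F ≡ + 4 * (+ n - + 4)
    at (v , ∣v∣ , v∈k) = trans (e (M k 0F) (M k 1F) (M k 2F))
      (trans (cong (λ k → 1ℤ * M k 0F + 1ℤ * M k 1F + 1ℤ * M k 2F) (sym v∈k))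
      (trans (sym (nbrSum-matrix (λ _ → 1ℤ) v ∣v∣)) (degree v ∣v∣)))

  β₀-positive : 0 < β 0
  β₀-positive = at layer-path
    where
    at : Path → 0 < β 0
    at (u , v , w , _ , (∣v∣ , ∣w∣ , vw) , _ , class-v , class-w) = subst (0 <_)
      (ℤ.+-injective (nbrs-matrix w 0F ∣w∣ class-w 1F))
      (nbrs-positive {w} 1F (∣w∣ , ∣v∣ , trans (adj-sym w v) vw) class-v)

  γ₂-positive : 0 < γ 2
  γ₂-positive = at layer-path
    where
    at : Path → 0 < γ 2
    at (u , v , w , uv@(∣u∣ , _) , _ , class-u , class-v , _) = subst (0 <_)
      (ℤ.+-injective (nbrs-matrix u 2F ∣u∣ class-u 1F)) (nbrs-positive {u} 1F uv class-v)

-- Excluding β₀ = γ₂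

in-D : Fin 3 → ℤ
in-D 0F = 1ℤ
in-D 1F = 0ℤ
in-D 2F = 1ℤ

-- i, j, k, l are in cyclic order, hence the signs.
Δ : (Fin 3 → ℤ) → Fin 3 → Fin 3 → Fin 3 → Fin 3 → ℤ
Δ h i j k l = h i - h j - h l + h k

-- If the difference of 1_D vanishes, the two diagonals of the 4-cycle carry equally many members of
-- D. So D contains no corner, the two ends of an edge, or all corners; its members are then linked
-- by edges and lie in one class, whose differences vanish as well. The 81 cases are checked by
-- decision.
cycle-differences : ∀ i j k l → nonadjacent i j ≡ false → nonadjacent j k ≡ false →
  nonadjacent k l ≡ false → nonadjacent l i ≡ false →
  (Δ in-D i j k l ≡ + 1 ⊎ Δ in-D i j k l ≡ + 2 ⊎ Δ in-D i j k l ≡ - + 1 ⊎ Δ in-D i j k l ≡ - + 2)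
    ⊎ (Δ (λ c → is c 0F) i j k l ≡ 0ℤ × Δ (λ c → is c 2F) i j k l ≡ 0ℤ)
cycle-differences = from-yes
  (all? λ i → all? λ j → all? λ k → all? λ l →
    (nonadjacent i j ≟ᵇ false) →-dec (nonadjacent j k ≟ᵇ false) →-dec
    (nonadjacent k l ≟ᵇ false) →-dec (nonadjacent l i ≟ᵇ false) →-dec
    ((Δ in-D i j k l ℤ.≟ + 1 ⊎-dec Δ in-D i j k l ℤ.≟ + 2
       ⊎-dec Δ in-D i j k l ℤ.≟ - + 1 ⊎-dec Δ in-D i j k l ℤ.≟ - + 2)
     ⊎-dec (Δ (λ c → is c 0F) i j k l ℤ.≟ 0ℤ ×-dec Δ (λ c → is c 2F) i j k l ℤ.≟ 0ℤ)))

Δ-class : (h : Fin 3 → ℤ) → ∀ i j k l → Δ h i j k l ≡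
  h 0F * Δ (λ c → is c 0F) i j k l + h 1F * Δ (λ c → is c 1F) i j k l + h 2F * Δ (λ c → is c 2F) i j k l
Δ-class h i j k l = trans
  (cong₂ _+_ (cong₂ _-_ (cong₂ _-_ (by-class h i) (by-class h j)) (by-class h l)) (by-class h k))
  (e (h 0F) (h 1F) (h 2F) (is i 0F) (is i 1F) (is i 2F) (is j 0F) (is j 1F) (is j 2F)
     (is k 0F) (is k 1F) (is k 2F) (is l 0F) (is l 1F) (is l 2F))
  where
  e : ∀ a b c i₀ i₁ i₂ j₀ j₁ j₂ k₀ k₁ k₂ l₀ l₁ l₂ →
    (a * i₀ + b * i₁ + c * i₂) - (a * j₀ + b * j₁ + c * j₂) - (a * l₀ + b * l₁ + c * l₂) + (a * k₀ + b * k₁ + c * k₂)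
      ≡ a * (i₀ - j₀ - l₀ + k₀) + b * (i₁ - j₁ - l₁ + k₁) + c * (i₂ - j₂ - l₂ + k₂)
  e = solve-∀

pos* : ∀ {a b} → 0ℤ <ᶻ a → 0ℤ <ᶻ b → 0ℤ <ᶻ a * b
pos* {+[1+ _ ]} {+[1+ _ ]} (+<+ _) (+<+ _) = +<+ (s≤s z≤n)

pos-difference : ∀ {k n} → k < n → 0ℤ <ᶻ + n - + k
pos-difference {k} {n} k<n = subst (_<ᶻ + n - + k) (ℤ.+-inverseʳ (+ k)) (ℤ.+-monoˡ-< (- (+ k)) (+<+ k<n))

AllPairs-All : ∀ {A : Set} {R S : A → A → Set} {P : A → Set} → (∀ {x y} → P x → P y → R x y → S x y) →
  ∀ {xs} → All P xs → AllPairs R xs → AllPairs S xs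
AllPairs-All f []       []       = []
AllPairs-All f (p ∷ ps) (r ∷ rs) = All.zipWith (λ { (q , xy) → f p q xy }) (ps , r) ∷ AllPairs-All f ps rs

adj-⊹ : ∀ {n} {a b c x y : Fin n} → Distinct₄ a b c x → Distinct₄ a b c y → x ≢ y → adj (quad a b c x) (quad a b c y) ≡ true
adj-⊹ {n} {a} {b} {c} {x} {y} d@((ab , ac , bc) , ax , bx , cx) (_ , ay , by , cy) xy = ≡⇒≡ᵇ
  (trans (⊹-∩-⊹-size (triple a b c) x y xy (∉-triple ax bx cx) (∉-triple ay by cy))
    (ℕ.suc-injective (trans (sym (∣⊹∣ (triple a b c) x (∉-triple ax bx cx))) (∣quad∣ d))))

adj-⊹₃ : ∀ {n} {a b x y d : Fin n} → Distinct₄ a b x d → Distinct₄ a b y d → x ≢ y → adj (quad a b x d) (quad a b y d) ≡ true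
adj-⊹₃ {n} {a} {b} {x} {y} {d} ((ab , ax , bx) , ad , bd , xd) ((_ , ay , by) , _ , _ , yd) xy =
  trans (cong₂ adj (⊹-comm (⊥ ⊹ a ⊹ b) x d) (⊹-comm (⊥ ⊹ a ⊹ b) y d))
    (adj-⊹ {a = a} {b} {d} ((ab , ad , bd) , ax , bx , ≢-sym xd) ((ab , ad , bd) , ay , by , ≢-sym yd) xy)

∑ₗ-const : ∀ {A : Set} (xs : List A) c → ∑ₗ xs (λ _ → c) ≡ c * + length xs
∑ₗ-const []       c = sym (ℤ.*-zeroʳ c)
∑ₗ-const (x ∷ xs) c = trans (cong (λ z → c + z) (∑ₗ-const xs c)) (sym (ℤ.*-suc c (+ length xs)))

-- There are 70 vertices for n = 8 and 210 for n = 10, so the equation reads 18 d = 280 or 24 d =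
-- 1260; neither has an integral solution.
indivisible : ∀ n d → (+ 3 * + n - + 6) * d ≡ (+ n - + 4) * + length (vertices n) → n ≢ 8 × n ≢ 10
indivisible n d e = (λ { refl → from-no (18 ∣? 280) (divides ℤ.∣ d ∣ (multiple 18 280 e)) })
                  , (λ { refl → from-no (24 ∣? 1260) (divides ℤ.∣ d ∣ (multiple 24 1260 e)) })
  where
  multiple : ∀ a b → + a * d ≡ + b → b ≡ ℤ.∣ d ∣ ℕ.* a
  multiple a b e = trans (sym (cong ℤ.∣_∣ e)) (trans (ℤ.abs-* (+ a) d) (ℕ.*-comm a _))

-- The hypotheses are what β₀ = γ₂ forces.
module EqualEnds {n} (8≤n : 8 ≤ n) (C : Code n) (α β γ : ℕ → ℕ) (regular : IsCompletelyRegular C 2 α β γ)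
  (α₀-eq : + α 0 ≡ + 2 * + n - + 14) (β₀-eq : + β 0 ≡ + 2 * + n - + 2)
  (ends : + γ 1 + + β 1 ≡ + n - + 4) (α₁-eq : + α 1 ≡ + 3 * + n - + 12)
  (γ₂-eq : + γ 2 ≡ + 2 * + n - + 2) (α₂-eq : + α 2 ≡ + 2 * + n - + 14) where

  open CompletelyRegular C α β γ regular

  N b c : ℤ
  N = + n
  b = + β 1
  c = + γ 1

  f g : Fin 3 → ℤ
  f 0F = b
  f 1F = 0ℤ
  f 2F = - c
  g 0F = + 2 * N - + 2
  g 1F = - (N - + 4)
  g 2F = + 2 * N - + 2

  -- As f vanishes on C₁, the end rows only need α₀ = α₂ = θ₂ = 2n - 14. The values on C and C₂ are
  -- chosen so that the middle row cancels: β₁ γ₁ - γ₁ β₁.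
  f-rows : ∀ k → f 0F * M k 0F + f 1F * M k 1F + f 2F * M k 2F + + 4 * f k ≡ (+ 2 * N - + 10) * f k
  f-rows 0F = trans (cong (λ a → b * a + 0ℤ * + β 0 + - c * 0ℤ + + 4 * b) α₀-eq) (e b c (+ β 0) N)
    where e : ∀ b c β₀ N → b * (+ 2 * N - + 14) + 0ℤ * β₀ + - c * 0ℤ + + 4 * b ≡ (+ 2 * N - + 10) * b
          e = solve-∀
  f-rows 1F = e b c (+ α 1) N
    where e : ∀ b c α₁ N → b * c + 0ℤ * α₁ + - c * b + + 4 * 0ℤ ≡ (+ 2 * N - + 10) * 0ℤ
          e = solve-∀
  f-rows 2F = trans (cong (λ a → b * 0ℤ + 0ℤ * + γ 2 + - c * a + + 4 * - c) α₂-eq) (e b c (+ γ 2) N)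
    where e : ∀ b c γ₂ N → b * 0ℤ + 0ℤ * γ₂ + - c * (+ 2 * N - + 14) + + 4 * - c ≡ (+ 2 * N - + 10) * - c
          e = solve-∀

  -- With equal ends, D and C₁ form an equitable partition with quotient rows (2n - 14, 2n - 2) and
  -- (n - 4, 3n - 12). Its eigenvalue other than the valency is n - 10 = θ₃, and g is the
  -- eigenvector.
  g-rows : ∀ k → g 0F * M k 0F + g 1F * M k 1F + g 2F * M k 2F + + 4 * g k ≡ (N - + 6) * g k
  g-rows 0F = trans (cong₂ (λ a b → g 0F * a + g 1F * b + g 2F * 0ℤ + + 4 * g 0F) α₀-eq β₀-eq) (e N)
    where e : ∀ N → (+ 2 * N - + 2) * (+ 2 * N - + 14) + - (N - + 4) * (+ 2 * N - + 2) + (+ 2 * N - + 2) * 0ℤ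
              + + 4 * (+ 2 * N - + 2) ≡ (N - + 6) * (+ 2 * N - + 2)
          e = solve-∀
  g-rows 1F = trans (regroup (+ 2 * N - + 2) (- (N - + 4)) c b (+ α 1))
      (trans (cong₂ (λ s a → (+ 2 * N - + 2) * s + - (N - + 4) * a + + 4 * - (N - + 4)) ends α₁-eq) (e N))
    where
    regroup : ∀ p q c b a → p * c + q * a + p * b + + 4 * q ≡ p * (c + b) + q * a + + 4 * q
    regroup = solve-∀
    e : ∀ N → (+ 2 * N - + 2) * (N - + 4) + - (N - + 4) * (+ 3 * N - + 12) + + 4 * - (N - + 4) ≡ (N - + 6) * - (N - + 4)
    e = solve-∀
  g-rows 2F = trans (cong₂ (λ a b → g 0F * 0ℤ + g 1F * b + g 2F * a + + 4 * g 2F) α₂-eq γ₂-eq) (e N)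
    where e : ∀ N → (+ 2 * N - + 2) * 0ℤ + - (N - + 4) * (+ 2 * N - + 2) + (+ 2 * N - + 2) * (+ 2 * N - + 14)
              + + 4 * (+ 2 * N - + 2) ≡ (N - + 6) * (+ 2 * N - + 2)
          e = solve-∀

  f-eigen : ∀ v → IsVertex v →
    nbrSum (λ w → f (class w)) v + + 4 * f (class v) ≡ (+ 2 * N - + 10) * f (class v)
  f-eigen = eigenfunction f (+ 2 * N - + 10) f-rows

  g-eigen : ∀ v → IsVertex v → nbrSum (λ w → g (class w)) v + + 4 * g (class v) ≡ (N - + 6) * g (class v)
  g-eigen = eigenfunction g (N - + 6) g-rows

  module F₂ = Eigenfunction₂ 8≤n (λ w → f (class w)) f-eigen
  module G₃ = Eigenfunction₃ 8≤n (λ w → g (class w)) g-eigen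

  g-in-D : ∀ k → g k ≡ (+ 3 * N - + 6) * in-D k - (N - + 4)
  g-in-D 0F = e N
    where e : ∀ N → + 2 * N - + 2 ≡ (+ 3 * N - + 6) * 1ℤ - (N - + 4)
          e = solve-∀
  g-in-D 1F = e N
    where e : ∀ N → - (N - + 4) ≡ (+ 3 * N - + 6) * 0ℤ - (N - + 4)
          e = solve-∀
  g-in-D 2F = e N
    where e : ∀ N → + 2 * N - + 2 ≡ (+ 3 * N - + 6) * 1ℤ - (N - + 4)
          e = solve-∀

  Δ-g : ∀ i j k l → Δ g i j k l ≡ (+ 3 * N - + 6) * Δ in-D i j k l
  Δ-g i j k l = trans (cong₂ _+_ (cong₂ _-_ (cong₂ _-_ (g-in-D i) (g-in-D j)) (g-in-D l)) (g-in-D k))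
    (e (+ 3 * N - + 6) (N - + 4) (in-D i) (in-D j) (in-D k) (in-D l))
    where
    e : ∀ p q i j k l → (p * i - q) - (p * j - q) - (p * l - q) + (p * k - q) ≡ p * (i - j - l + k)
    e = solve-∀

  -- Counting along edges multiplies this sum by the valency 4(n - 4), the eigenvalue equation by n
  -- - 10; the two differ by 3(n - 2).
  ∑g≡0 : ∑ₗ (vertices n) (λ v → g (class v)) ≡ 0ℤ
  ∑g≡0 = cancel {3} {0} (s≤s z≤n) (cancel {n} {2} (ℕ.≤-trans (s≤s (s≤s (s≤s z≤n))) 8≤n)
    (difference (trans (sym (∑-nbrSum (λ v → g (class v)))) eigen-sum) (shape N _)))
    where
    shape : ∀ N s → (N - + 2) * ((+ 3 - + 0) * s) ≡ (+ 4 * (N - + 4)) * s - (N - + 10) * s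
    shape = solve-∀
    to-θ : ∀ s t → s ≡ (s + + 4 * t) - + 4 * t
    to-θ = solve-∀
    θ-form : ∀ N t → (N - + 6) * t - + 4 * t ≡ (N - + 10) * t
    θ-form = solve-∀
    eigen-sum : ∑ₗ (vertices n) (nbrSum (λ v → g (class v))) ≡ (N - + 10) * ∑ₗ (vertices n) (λ v → g (class v))
    eigen-sum = trans (∑-vertices-cong (λ v ∣v∣ → trans (to-θ (nbrSum (λ w → g (class w)) v) (g (class v)))
        (trans (cong (_- + 4 * g (class v)) (g-eigen v ∣v∣)) (θ-form N (g (class v))))))
      (∑ₗ-distribˡ-* (vertices n) (N - + 10) (λ v → g (class v)))

  ∣D∣ : ℤ
  ∣D∣ = ∑ₗ (vertices n) (λ v → in-D (class v))

  ∣D∣-eq : (+ 3 * N - + 6) * ∣D∣ ≡ (N - + 4) * + length (vertices n)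
  ∣D∣-eq = ℤ.i-j≡0⇒i≡j _ _ (begin
    p * ∣D∣ - q * len
      ≡⟨ neg-out p ∣D∣ q len ⟩
    p * ∣D∣ + (- q) * len
      ≡⟨ cong₂ _+_ (sym (∑ₗ-distribˡ-* V p (λ v → in-D (class v)))) (sym (∑ₗ-const V (- q))) ⟩
    ∑ₗ V (λ v → p * in-D (class v)) + ∑ₗ V (λ _ → - q)
      ≡⟨ sym (∑ₗ-distrib-+ V (λ v → p * in-D (class v)) (λ _ → - q)) ⟩
    ∑ₗ V (λ v → p * in-D (class v) - q)
      ≡⟨ ∑ₗ-cong V (λ v → sym (g-in-D (class v))) ⟩
    ∑ₗ V (λ v → g (class v))
      ≡⟨ ∑g≡0 ⟩
    0ℤ ∎)
    where
    open ≡-Reasoning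
    V = vertices n
    p q len : ℤ
    p = + 3 * N - + 6
    q = N - + 4
    len = + length V
    neg-out : ∀ p d q l → p * d - q * l ≡ p * d + (- q) * l
    neg-out = solve-∀

  -- The value of τ s + τ t for a second difference 1 of 1_D: n - 6 is the eigenvalue of A + 4, and
  -- 3(n - 2) = (2n - 2) + (n - 4) is the gap between the two values of g.
  K : ℤ
  K = (N - + 6) * ((+ 3 - + 0) * (N - + 2))

  0<K : 0ℤ <ᶻ K
  0<K = pos* (pos-difference (ℕ.≤-trans (s≤s (s≤s (s≤s (s≤s (s≤s (s≤s (s≤s z≤n))))))) 8≤n))
    (pos* (pos-difference {0} {3} (s≤s z≤n)) (pos-difference (ℕ.≤-trans (s≤s (s≤s (s≤s z≤n))) 8≤n)))

  open SmallPairSums 0<K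

  multiple⇒Small : ∀ {e} → e ≡ + 1 ⊎ e ≡ + 2 ⊎ e ≡ - + 1 ⊎ e ≡ - + 2 → Small ((N - + 6) * ((+ 3 * N - + 6) * e))
  multiple⇒Small (inj₁ refl)               = +one (e N)
    where e : ∀ N → (N - + 6) * ((+ 3 * N - + 6) * + 1) ≡ (N - + 6) * ((+ 3 - + 0) * (N - + 2))
          e = solve-∀
  multiple⇒Small (inj₂ (inj₁ refl))        = +two (e N)
    where e : ∀ N → (N - + 6) * ((+ 3 * N - + 6) * + 2) ≡ (N - + 6) * ((+ 3 - + 0) * (N - + 2)) + (N - + 6) * ((+ 3 - + 0) * (N - + 2))
          e = solve-∀
  multiple⇒Small (inj₂ (inj₂ (inj₁ refl))) = -one (e N)
    where e : ∀ N → (N - + 6) * ((+ 3 * N - + 6) * - + 1) ≡ - ((N - + 6) * ((+ 3 - + 0) * (N - + 2)))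
          e = solve-∀
  multiple⇒Small (inj₂ (inj₂ (inj₂ refl))) = -two (e N)
    where e : ∀ N → (N - + 6) * ((+ 3 * N - + 6) * - + 2) ≡ - ((N - + 6) * ((+ 3 - + 0) * (N - + 2)) + (N - + 6) * ((+ 3 - + 0) * (N - + 2)))
          e = solve-∀

  Avoids : (x y z w s : Fin n) → Set
  Avoids x y z w s = All (_≢ s) (x ∷ y ∷ z ∷ w ∷ [])

  module Curved (x y z w : Fin n) (xyzw : Distinct₄ x y z w) (ΔΔ≢0 : F₂.ΔΔ x y z w ≢ 0ℤ) where

    x≢y = proj₁ (proj₁ xyzw)
    x≢z = proj₁ (proj₂ (proj₁ xyzw))
    y≢z = proj₂ (proj₂ (proj₁ xyzw))
    x≢w = proj₁ (proj₂ xyzw)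
    y≢w = proj₁ (proj₂ (proj₂ xyzw))
    z≢w = proj₂ (proj₂ (proj₂ xyzw))

    τ-sum-small : ∀ {s t} → Avoids x y z w s → Avoids x y z w t → s ≢ t → Small (G₃.τ x y z w s + G₃.τ x y z w t)
    τ-sum-small {s} {t} (x≢s ∷ y≢s ∷ z≢s ∷ w≢s ∷ []) (x≢t ∷ y≢t ∷ z≢t ∷ w≢t ∷ []) s≢t =
      subst Small (sym τ-value) (multiple⇒Small (small (cycle-differences i j k l ij jk kl li)))
      where
      xz : Distinct₄ s t x z
      xz = (s≢t , ≢-sym x≢s , ≢-sym x≢t) , ≢-sym z≢s , ≢-sym z≢t , x≢z
      yz : Distinct₄ s t y z
      yz = (s≢t , ≢-sym y≢s , ≢-sym y≢t) , ≢-sym z≢s , ≢-sym z≢t , y≢z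
      xw : Distinct₄ s t x w
      xw = (s≢t , ≢-sym x≢s , ≢-sym x≢t) , ≢-sym w≢s , ≢-sym w≢t , x≢w
      yw : Distinct₄ s t y w
      yw = (s≢t , ≢-sym y≢s , ≢-sym y≢t) , ≢-sym w≢s , ≢-sym w≢t , y≢w
      -- In this order the four sets run around a 4-cycle in J(n,4), each step replacing x and y, or
      -- z and w, by one another.
      i = class (quad s t x z)
      j = class (quad s t y z)
      k = class (quad s t y w)
      l = class (quad s t x w)
      ij : nonadjacent i j ≡ false
      ij = adjacent-classes (quad s t x z) (quad s t y z) (∣quad∣ xz) (∣quad∣ yz) (adj-⊹₃ xz yz x≢y)
      jk : nonadjacent j k ≡ false
      jk = adjacent-classes (quad s t y z) (quad s t y w) (∣quad∣ yz) (∣quad∣ yw) (adj-⊹ yz yw z≢w)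
      kl : nonadjacent k l ≡ false
      kl = adjacent-classes (quad s t y w) (quad s t x w) (∣quad∣ yw) (∣quad∣ xw) (adj-⊹₃ yw xw (≢-sym x≢y))
      li : nonadjacent l i ≡ false
      li = adjacent-classes (quad s t x w) (quad s t x z) (∣quad∣ xw) (∣quad∣ xz) (adj-⊹ xw xz (≢-sym z≢w))
      second-difference : ∀ (h : Fin 3 → ℤ) →
        tuple (λ v → h (class v)) s t x z - tuple (λ v → h (class v)) s t y z
          - tuple (λ v → h (class v)) s t x w + tuple (λ v → h (class v)) s t y w ≡ Δ h i j k l
      second-difference h = cong₂ _+_ (cong₂ _-_ (cong₂ _-_ (tuple-quad hc xz) (tuple-quad hc yz)) (tuple-quad hc xw)) (tuple-quad hc yw)
        where hc = λ v → h (class v)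
      τ-value : G₃.τ x y z w s + G₃.τ x y z w t ≡ (N - + 6) * ((+ 3 * N - + 6) * Δ in-D i j k l)
      τ-value = trans (G₃.second-difference-τ x y z w s t xz yz xw yw)
        (cong ((N - + 6) *_) (trans (second-difference g) (Δ-g i j k l)))
      -- The second difference of f is not zero, so that of 1_D is not zero either.
      small : ∀ {A : Set} → A ⊎ (Δ (λ c → is c 0F) i j k l ≡ 0ℤ × Δ (λ c → is c 2F) i j k l ≡ 0ℤ) → A
      small (inj₁ a)         = a
      small (inj₂ (p₀ , p₂)) = ⊥-elim (ΔΔ≢0 (F₂.flat-tuple⇒flat s t x y z w xz yz xw yw
        (trans (second-difference f) (trans (Δ-class f i j k l)
          (trans (cong₂ (λ p q → b * p + 0ℤ * Δ (λ c → is c 1F) i j k l + - c * q) p₀ p₂)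
            (vanish b c (Δ (λ c → is c 1F) i j k l)))))))
        where
        vanish : ∀ b c p → b * 0ℤ + 0ℤ * p + - c * 0ℤ ≡ 0ℤ
        vanish = solve-∀

    open Complement (complement (x ∷ y ∷ z ∷ w ∷ [])
      ((x≢y ∷ x≢z ∷ x≢w ∷ []) ∷ (y≢z ∷ y≢w ∷ []) ∷ (z≢w ∷ []) ∷ [] ∷ []))

    τs : List ℤ
    τs = map (G₃.τ x y z w) others

    size : ∀ m → 4 ℕ.+ m ≡ n → Size m
    size 5 _ = inj₁ refl
    size (suc (suc (suc (suc (suc (suc (suc m))))))) _ = inj₂ (s≤s (s≤s (s≤s (s≤s (s≤s (s≤s (s≤s z≤n)))))))
    size 4 e = ⊥-elim (proj₁ (indivisible n ∣D∣ ∣D∣-eq) (sym e))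
    size 6 e = ⊥-elim (proj₂ (indivisible n ∣D∣ ∣D∣-eq) (sym e))
    size 0 e = ⊥-elim (from-no (8 ℕ.≤? 4) (subst (8 ≤_) (sym e) 8≤n))
    size 1 e = ⊥-elim (from-no (8 ℕ.≤? 5) (subst (8 ≤_) (sym e) 8≤n))
    size 2 e = ⊥-elim (from-no (8 ℕ.≤? 6) (subst (8 ≤_) (sym e) 8≤n))
    size 3 e = ⊥-elim (from-no (8 ℕ.≤? 7) (subst (8 ≤_) (sym e) 8≤n))

    τs-sum : ∑ₗ τs (λ t → t) ≡ 0ℤ
    τs-sum = trans (∑ₗ-map (G₃.τ x y z w) others (λ t → t)) (trans (sym (ℤ.+-identityˡ _))
      (trans (cong (_+ ∑ₗ others (G₃.τ x y z w)) (sym (G₃.sum-τ-corners x y z w)))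
        (trans (sym (sum-split (G₃.τ x y z w))) (G₃.sum-τ x y z w))))

    impossible : Empty
    impossible = no-small-pair-sums τs
      (subst Size (sym (length-map (G₃.τ x y z w) others)) (size (length others) length-split))
      (AllPairs.map⁺ (AllPairs-All τ-sum-small others-avoid others-distinct))
      τs-sum

  flat : ∀ x y z w → Distinct₄ x y z w → F₂.ΔΔ x y z w ≡ 0ℤ
  flat x y z w xyzw = decidable-stable (F₂.ΔΔ x y z w ℤ.≟ 0ℤ) (Curved.impossible x y z w xyzw)

  f≡0 : ∀ k → f k ≡ 0ℤ
  f≡0 k = at (inhabited k)
    where
    at : (∃ λ v → IsVertex v × class v ≡ k) → f k ≡ 0ℤ
    at (v , ∣v∣ , v∈k) = trans (cong f (sym v∈k)) (F₂.P≡0⇒φ≡0 (F₂.flat⇒P≡0 F₂.Q≡0 flat) v ∣v∣)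

  impossible : Empty
  impossible = not-pos (pos-difference (ℕ.≤-trans (s≤s (s≤s (s≤s (s≤s (s≤s z≤n))))) 8≤n))
    (trans (sym ends) (trans (e b c) (cong₂ (λ u v → u - v) (f≡0 0F) (f≡0 2F))))
    where
    e : ∀ b c → c + b ≡ b - - c
    e = solve-∀

-- With row sums k the characteristic polynomial at k - λ is -λ (λ² - S λ + Π).
module Spectrum {n} (8≤n : 8 ≤ n) (α β γ : ℕ → ℕ)
  (row-sum : ∀ k → intersectionMatrix α β γ k 0F + intersectionMatrix α β γ k 1F + intersectionMatrix α β γ k 2F ≡ + 4 * (+ n - + 4))
  (θ₂ : IsEigenvalue (θ n 2) (intersectionMatrix α β γ))
  (θ₃ : IsEigenvalue (θ n 3) (intersectionMatrix α β γ)) where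

  N k b g c₁ b₁ S Π : ℤ
  N  = + n
  k  = + 4 * (N - + 4)
  b  = + β 0
  g  = + γ 2
  c₁ = + γ 1
  b₁ = + β 1
  S  = b + c₁ + b₁ + g
  Π  = b * b₁ + b * g + c₁ * g

  α₀-eq : + α 0 ≡ k - b
  α₀-eq = trans (e (+ α 0) b) (cong (_- b) (row-sum 0F))
    where e : ∀ a b → a ≡ (a + b + 0ℤ) - b
          e = solve-∀

  α₁-eq : + α 1 ≡ k - c₁ - b₁
  α₁-eq = trans (e (+ α 1) c₁ b₁) (cong (λ z → z - c₁ - b₁) (row-sum 1F))
    where e : ∀ a c b → a ≡ (c + a + b) - c - b
          e = solve-∀

  α₂-eq : + α 2 ≡ k - g
  α₂-eq = trans (e (+ α 2) g) (cong (_- g) (row-sum 2F))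
    where e : ∀ a b → a ≡ (0ℤ + b + a) - b
          e = solve-∀

  -- The determinant of `shift x` with the diagonal entries left free, so that the row sums can be
  -- substituted for them.
  char : (x a₀ a₁ a₂ : ℤ) → ℤ
  char x a₀ a₁ a₂ =
      (x - a₀) * ((x - a₁) * (x - a₂) - (0ℤ - b₁) * (0ℤ - g))
    - (0ℤ - b) * ((0ℤ - c₁) * (x - a₂) - (0ℤ - b₁) * (0ℤ - 0ℤ))
    + (0ℤ - 0ℤ) * ((0ℤ - c₁) * (0ℤ - g) - (x - a₁) * (0ℤ - 0ℤ))

  char≡0 : ∀ x → IsEigenvalue x (intersectionMatrix α β γ) → char x (k - b) (k - c₁ - b₁) (k - g) ≡ 0ℤ
  char≡0 x e = trans (sym (trans (cong (λ a → char x a (+ α 1) (+ α 2)) α₀-eq)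
    (cong₂ (λ a a′ → char x (k - b) a a′) α₁-eq α₂-eq))) e

  -- Here λ = k - θ₂ = 2n - 2 is a nonzero root of the cubic, so its factor λ = 2(n - 1) cancels;
  -- `quadratic₃` does the same with λ = k - θ₃ = 3n - 6.
  quadratic₂ : (+ 2 * N - + 2) * (+ 2 * N - + 2) - S * (+ 2 * N - + 2) + Π ≡ 0ℤ
  quadratic₂ = cancel {n} {1} (ℕ.≤-trans (s≤s (s≤s z≤n)) 8≤n) (cancel {2} {0} (s≤s z≤n)
    (trans (e N b g c₁ b₁) (cong -_ (char≡0 (θ n 2) θ₂))))
    where
    e : ∀ N b g c₁ b₁ → (+ 2 - + 0) * ((N - + 1) *
        ((+ 2 * N - + 2) * (+ 2 * N - + 2) - (b + c₁ + b₁ + g) * (+ 2 * N - + 2) + (b * b₁ + b * g + c₁ * g))) ≡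
      - ( (((N - + 4 - + 2) * (+ 4 - + 2) - + 2) - (+ 4 * (N - + 4) - b)) *
            ((((N - + 4 - + 2) * (+ 4 - + 2) - + 2) - (+ 4 * (N - + 4) - c₁ - b₁)) * (((N - + 4 - + 2) * (+ 4 - + 2) - + 2) - (+ 4 * (N - + 4) - g))
              - (0ℤ - b₁) * (0ℤ - g))
        - (0ℤ - b) * ((0ℤ - c₁) * (((N - + 4 - + 2) * (+ 4 - + 2) - + 2) - (+ 4 * (N - + 4) - g)) - (0ℤ - b₁) * (0ℤ - 0ℤ))
        + (0ℤ - 0ℤ) * ((0ℤ - c₁) * (0ℤ - g) - (((N - + 4 - + 2) * (+ 4 - + 2) - + 2) - (+ 4 * (N - + 4) - c₁ - b₁)) * (0ℤ - 0ℤ)))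
    e = solve-∀

  quadratic₃ : (+ 3 * N - + 6) * (+ 3 * N - + 6) - S * (+ 3 * N - + 6) + Π ≡ 0ℤ
  quadratic₃ = cancel {n} {2} (ℕ.≤-trans (s≤s (s≤s (s≤s z≤n))) 8≤n) (cancel {3} {0} (s≤s z≤n)
    (trans (e N b g c₁ b₁) (cong -_ (char≡0 (θ n 3) θ₃))))
    where
    e : ∀ N b g c₁ b₁ → (+ 3 - + 0) * ((N - + 2) *
        ((+ 3 * N - + 6) * (+ 3 * N - + 6) - (b + c₁ + b₁ + g) * (+ 3 * N - + 6) + (b * b₁ + b * g + c₁ * g))) ≡
      - ( (((N - + 4 - + 3) * (+ 4 - + 3) - + 3) - (+ 4 * (N - + 4) - b)) *
            ((((N - + 4 - + 3) * (+ 4 - + 3) - + 3) - (+ 4 * (N - + 4) - c₁ - b₁)) * (((N - + 4 - + 3) * (+ 4 - + 3) - + 3) - (+ 4 * (N - + 4) - g))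
              - (0ℤ - b₁) * (0ℤ - g))
        - (0ℤ - b) * ((0ℤ - c₁) * (((N - + 4 - + 3) * (+ 4 - + 3) - + 3) - (+ 4 * (N - + 4) - g)) - (0ℤ - b₁) * (0ℤ - 0ℤ))
        + (0ℤ - 0ℤ) * ((0ℤ - c₁) * (0ℤ - g) - (((N - + 4 - + 3) * (+ 4 - + 3) - + 3) - (+ 4 * (N - + 4) - c₁ - b₁)) * (0ℤ - 0ℤ)))
    e = solve-∀

  -- Vieta for the roots 2n - 2 and 3n - 6: the difference of the two quadratics has the factor n -
  -- 4, the difference of the roots.
  S-eq : S - (+ 5 * N - + 8) ≡ 0ℤ
  S-eq = cancel {n} {4} (ℕ.≤-trans (s≤s (s≤s (s≤s (s≤s (s≤s z≤n))))) 8≤n)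
    (trans (e N S Π) (cong₂ (λ u v → u - v) quadratic₂ quadratic₃))
    where
    e : ∀ N S Π → (N - + 4) * (S - (+ 5 * N - + 8)) ≡
      ((+ 2 * N - + 2) * (+ 2 * N - + 2) - S * (+ 2 * N - + 2) + Π) - ((+ 3 * N - + 6) * (+ 3 * N - + 6) - S * (+ 3 * N - + 6) + Π)
    e = solve-∀

  Π-eq : Π - (+ 2 * N - + 2) * (+ 3 * N - + 6) ≡ 0ℤ
  Π-eq = trans (e N S Π) (trans (cong₂ (λ u v → u + (+ 2 * N - + 2) * v) quadratic₂ S-eq)
    (trans (ℤ.+-identityˡ _) (ℤ.*-zeroʳ (+ 2 * N - + 2))))
    where
    e : ∀ N S Π → Π - (+ 2 * N - + 2) * (+ 3 * N - + 6) ≡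
      ((+ 2 * N - + 2) * (+ 2 * N - + 2) - S * (+ 2 * N - + 2) + Π) + (+ 2 * N - + 2) * (S - (+ 5 * N - + 8))
    e = solve-∀

  combine : ∀ x y {u v} → u ≡ 0ℤ → v ≡ 0ℤ → x * u + y * v ≡ 0ℤ
  combine x y refl refl = trans (cong₂ _+_ (ℤ.*-zeroʳ x) (ℤ.*-zeroʳ y)) refl

  -- S b - Π collapses to b² + c₁ (b - g), so c₁ (b - g) is minus the quadratic λ² - S λ + Π at λ =
  -- b, which factors through its roots 2n - 2 and 3n - 6. In the same way S g - Π = g² - b₁ (b - g)
  -- gives `β₁-eq`.
  γ₁-eq : c₁ * (b - g) ≡ - ((b - + 2 * N + + 2) * (b - + 3 * N + + 6))
  γ₁-eq = ℤ.i-j≡0⇒i≡j _ _ (trans (e N b g c₁ b₁) (combine b (- 1ℤ) S-eq Π-eq))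
    where
    e : ∀ N b g c₁ b₁ → c₁ * (b - g) - - ((b - + 2 * N + + 2) * (b - + 3 * N + + 6)) ≡
      b * ((b + c₁ + b₁ + g) - (+ 5 * N - + 8)) + - 1ℤ * ((b * b₁ + b * g + c₁ * g) - (+ 2 * N - + 2) * (+ 3 * N - + 6))
    e = solve-∀

  β₁-eq : b₁ * (b - g) ≡ (g - + 2 * N + + 2) * (g - + 3 * N + + 6)
  β₁-eq = ℤ.i-j≡0⇒i≡j _ _ (trans (e N b g c₁ b₁) (combine (- g) 1ℤ S-eq Π-eq))
    where
    e : ∀ N b g c₁ b₁ → b₁ * (b - g) - (g - + 2 * N + + 2) * (g - + 3 * N + + 6) ≡
      - g * ((b + c₁ + b₁ + g) - (+ 5 * N - + 8)) + 1ℤ * ((b * b₁ + b * g + c₁ * g) - (+ 2 * N - + 2) * (+ 3 * N - + 6))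
    e = solve-∀

  k-shape : ∀ x → k - x ≡ + 4 * N - + 16 - x
  k-shape x = e N x
    where e : ∀ N x → + 4 * (N - + 4) - x ≡ + 4 * N - + 16 - x
          e = solve-∀

  α₁-eq′ : + α 1 ≡ b + g - N - + 8
  α₁-eq′ = trans α₁-eq (ℤ.i-j≡0⇒i≡j _ _ (trans (e N b g c₁ b₁) (cong -_ S-eq)))
    where
    e : ∀ N b g c₁ b₁ → (+ 4 * (N - + 4) - c₁ - b₁) - (b + g - N - + 8) ≡ - ((b + c₁ + b₁ + g) - (+ 5 * N - + 8))
    e = solve-∀

  -- By `γ₁-eq`, b is then one of the two roots. The root 3n - 6 would give c₁ + b₁ = 4 - n, which
  -- is negative.
  equal-ends : b ≡ g → b ≡ + 2 * N - + 2 × c₁ + b₁ ≡ N - + 4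
  equal-ends b≡g = [ small , (λ e → ⊥-elim (large e)) ]′
    (ℤ.i*j≡0⇒i≡0∨j≡0 (b - + 2 * N + + 2) (trans (sym (ℤ.neg-involutive _)) (cong -_ (trans (sym γ₁-eq)
      (trans (cong (c₁ *_) (ℤ.i≡j⇒i-j≡0 b≡g)) (ℤ.*-zeroʳ c₁))))))
    where
    ends : c₁ + b₁ ≡ + 5 * N - + 8 - b - b
    ends = ℤ.i-j≡0⇒i≡j _ _ (trans (e (c₁ + b₁) b (+ 5 * N - + 8))
      (trans (cong (λ g → b + (c₁ + b₁) + g - (+ 5 * N - + 8)) b≡g)
      (trans (regroup b c₁ b₁ g (+ 5 * N - + 8)) S-eq)))
      where
      e : ∀ s b t → s - (t - b - b) ≡ b + s + b - t
      e = solve-∀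
      regroup : ∀ b c b₁ g t → b + (c + b₁) + g - t ≡ b + c + b₁ + g - t
      regroup = solve-∀
    small : b - + 2 * N + + 2 ≡ 0ℤ → b ≡ + 2 * N - + 2 × c₁ + b₁ ≡ N - + 4
    small e = b-eq , trans ends (trans (cong (λ b → + 5 * N - + 8 - b - b) b-eq) (e₂ N))
      where
      e₁ : ∀ N b → b - (+ 2 * N - + 2) ≡ b - + 2 * N + + 2
      e₁ = solve-∀
      b-eq : b ≡ + 2 * N - + 2
      b-eq = ℤ.i-j≡0⇒i≡j _ _ (trans (e₁ N b) e)
      e₂ : ∀ N → + 5 * N - + 8 - (+ 2 * N - + 2) - (+ 2 * N - + 2) ≡ N - + 4
      e₂ = solve-∀
    large : b - + 3 * N + + 6 ≢ 0ℤ
    large e = not-pos (pos+ (ℤ.+≤+ {0} {γ 1 ℕ.+ β 1} z≤n) (pos-difference {4} (ℕ.≤-trans (s≤s (s≤s (s≤s (s≤s (s≤s z≤n))))) 8≤n)))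
      (trans (cong (_+ (N - + 4)) ends) (trans (e₂ N b) (cong (λ z → - (z + z)) e)))
      where
      e₂ : ∀ N b → + 5 * N - + 8 - b - b + (N - + 4) ≡ - ((b - + 3 * N + + 6) + (b - + 3 * N + + 6))
      e₂ = solve-∀

  β₀≢γ₂ : (C : Code n) → IsCompletelyRegular C 2 α β γ → β 0 ≢ γ 2
  β₀≢γ₂ C regular β₀≡γ₂ = EqualEnds.impossible 8≤n C α β γ regular
    (trans α₀-eq (trans (cong (λ z → k - z) b-eq) (e₁ N))) b-eq ends
    (trans α₁-eq (trans (e₂ k c₁ b₁) (trans (cong (λ z → k - z) ends) (e₃ N))))
    g-eq (trans α₂-eq (trans (cong (λ z → k - z) g-eq) (e₁ N)))
    where
    both : b ≡ + 2 * N - + 2 × c₁ + b₁ ≡ N - + 4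
    both = equal-ends (cong +_ β₀≡γ₂)
    b-eq = proj₁ both
    ends = proj₂ both
    g-eq : g ≡ + 2 * N - + 2
    g-eq = trans (sym (cong +_ β₀≡γ₂)) b-eq
    e₁ : ∀ N → + 4 * (N - + 4) - (+ 2 * N - + 2) ≡ + 2 * N - + 14
    e₁ = solve-∀
    e₂ : ∀ k c b → k - c - b ≡ k - (c + b)
    e₂ = solve-∀
    e₃ : ∀ N → + 4 * (N - + 4) - (N - + 4) ≡ + 3 * N - + 12
    e₃ = solve-∀

theorem7 : (n : ℕ) → 8 ≤ n → (C : Code n) → (α β γ : ℕ → ℕ) →
    IsCompletelyRegular C 2 α β γ →
    IsEigenvalue (θ n 0) (intersectionMatrix α β γ) →
    IsEigenvalue (θ n 2) (intersectionMatrix α β γ) →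
    IsEigenvalue (θ n 3) (intersectionMatrix α β γ) →
    Σ ℕ (λ b → Σ ℕ (λ g →
    (0 < b) × (0 < g) × (b ≢ g)
    × (β 0 ≡ b) × (γ 2 ≡ g)
    × (+ α 0 ≡ (+ 4) * (+ n) - (+ 16) - (+ b))
    × (+ γ 1 * ((+ b) - (+ g)) ≡ - (((+ b) - (+ 2) * (+ n) + (+ 2)) * ((+ b) - (+ 3) * (+ n) + (+ 6))))
    × (+ α 1 ≡ (+ b) + (+ g) - (+ n) - (+ 8))
    × (+ β 1 * ((+ b) - (+ g)) ≡ ((+ g) - (+ 2) * (+ n) + (+ 2)) * ((+ g) - (+ 3) * (+ n) + (+ 6)))
    × (+ α 2 ≡ (+ 4) * (+ n) - (+ 16) - (+ g))))
theorem7 n 8≤n C α β γ regular _ θ₂ θ₃ =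
  β 0 , γ 2 , β₀-positive , γ₂-positive , β₀≢γ₂ C regular , refl , refl ,
  trans α₀-eq (k-shape (+ β 0)) , γ₁-eq , α₁-eq′ , β₁-eq , trans α₂-eq (k-shape (+ γ 2))
  where
  open CompletelyRegular C α β γ regular using (row-sum; β₀-positive; γ₂-positive)
  open Spectrum 8≤n α β γ row-sum θ₂ θ₃
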